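{- For every $n\ge1$, the integer $\tilde k_{2n}(0)$ equals the number of pairs $(\sigma,r)$ where $\sigma\in\mathcal{M}^c(2n)$ and $r$ is an acyclic orientation of the crossing graph $G(\sigma)$ whose unique source is the arch of $\sigma$ containing $1$.
   Context: The integers $\tilde k_{2n}(0)$, $n\ge1$, are defined by $-\log\big(\sum_{n\ge0}(-1)^nC_n\frac{z^{2n}}{(2n)!}\big)=\sum_{n\ge1}\tilde k_{2n}(0)\frac{z^{2n}}{(2n)!}$, where $C_n=\frac{1}{n+1}\binom{2n}{n}$ is the Catalan number (equivalently, $\tilde k_{2n}(0)=(-1)^{n-1}k_{2n}$ where $k_n$ are the classical cumulants of the semicircular law on $[-2,2]$). $\mathcal{M}^c(2n)$ is the set of connected matchings of $\{1,\dots,2n\}$: set partitions into blocks (arches) of size $2$ such that no proper subinterval of $\{1,\dots,2n\}$ is a union of arches. The crossing graph $G(\sigma)$ has the arches as vertices and an edge between $\{i,j\}$ and $\{k,\ell\}$ iff $i<k<j<\ell$. A source of an orientation is a vertex with no incoming arcs. -}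

module Defs where

open import Data.Nat as ℕ using (ℕ; zero; suc; _%_; _!)
import Data.Nat.DivMod
open import Data.Nat.Properties using (_!≢0)
open import Data.Nat.Combinatorics using (_C_)
open import Data.Integer as ℤ using (ℤ; +_)
open import Data.Rational as ℚ using (ℚ; 0ℚ; 1ℚ; _+_; _*_; -_; _/_)
open import Data.Bool using (Bool; true; false)
open import Data.Fin as Fin using (Fin; toℕ)
open import Data.Vec using (Vec; lookup)
open import Data.List using (List; []; _∷_; upTo; map; foldr)
open import Data.Product using (_×_; Σ-syntax; _,_)
open import Data.Sum using (_⊎_)
open import Relation.Nullary using (¬_)
open import Relation.Binary.PropositionalEquality using (_≡_; _≢_)
open import Relation.Binary.Construct.Closure.Transitive using (TransClosure)

Series : Set
Series = ℕ → ℚ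

sumℚ : List ℚ → ℚ
sumℚ = foldr _+_ 0ℚ

_·_ : Series → Series → Series
(a · b) m = sumℚ (map (λ i → a i * b (m ℕ.∸ i)) (upTo (suc m)))

oneS : Series
oneS zero    = 1ℚ
oneS (suc _) = 0ℚ

_^S_ : Series → ℕ → Series
u ^S zero  = oneS
u ^S suc k = u · (u ^S k)

sgn : ℕ → ℚ
sgn zero    = 1ℚ
sgn (suc k) = - sgn k

catalan : ℕ → ℚ
catalan n = (+ ((2 ℕ.* n) C n)) / suc n

Mser : Series
Mser m with m % 2
... | zero  = sgn (m ℕ./ 2) * (catalan (m ℕ./ 2) * ((+ 1) / (m !)))
  where instance _ = m !≢0
... | suc _ = 0ℚ

User : Series
User zero    = 0ℚ
User (suc m) = Mser (suc m)

-- log M = log(1 + U) = Σ_{k≥1} (-1)^{k-1} U^k / k  (formal; only k ≤ m contributes to z^m)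
logM : Series
logM m = sumℚ (map (λ k → sgn k * (((+ 1) / suc k) * ((User ^S suc k) m))) (upTo m))

ktilde : ℕ → ℚ
ktilde n = (+ ((2 ℕ.* n) !) / 1) * (- logM (2 ℕ.* n))

-- Matchings of {1,…,N}, positions indexed by Fin N (position i ↔ i+1).
-- A matching is given by its partner function σ (a vector).

module _ {N : ℕ} (σ : Vec (Fin N) N) where

  partner : Fin N → Fin N
  partner i = lookup σ i

  IsMatching : Set
  IsMatching = ∀ i → (partner i ≢ i) × (partner (partner i) ≡ i)

  UnionOfArches : Fin N → Fin N → Set
  UnionOfArches a b = ∀ i → a Fin.≤ i → i Fin.≤ b →
                        (a Fin.≤ partner i) × (partner i Fin.≤ b)

  IsConnected : Set
  IsConnected = ∀ a b → a Fin.≤ b → ¬ ((toℕ a ≡ 0) × (suc (toℕ b) ≡ N)) →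
                ¬ UnionOfArches a b

  -- arches are identified by their left endpoint
  IsArch : Fin N → Set
  IsArch a = a Fin.< partner a

  Cross : Fin N → Fin N → Set
  Cross a b = (a Fin.< b) × (b Fin.< partner a) × (partner a Fin.< partner b)

  Edge : Fin N → Fin N → Set
  Edge a b = Cross a b ⊎ Cross b a

  -- An orientation r is given by its set of arcs (adjacency matrix):
  -- arcs only along edges, and each edge gets exactly one direction.
  module _ (r : Vec (Vec Bool N) N) where

    Arc : Fin N → Fin N → Set
    Arc a b = lookup (lookup r a) b ≡ true

    IsOrientation : Set
    IsOrientation = (∀ a b → Arc a b → Edge a b) ×
                    (∀ a b → Edge a b → (Arc a b × ¬ Arc b a) ⊎ (Arc b a × ¬ Arc a b))

    IsAcyclic : Set
    IsAcyclic = ∀ a → ¬ TransClosure Arc a a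

    IsSource : Fin N → Set
    IsSource v = ∀ b → ¬ Arc b v

    -- the unique source is the arch containing position 1 (index 0),
    -- whose left endpoint is index 0
    UniqueSourceAtOne : Set
    UniqueSourceAtOne = (∀ v → toℕ v ≡ 0 → IsSource v) ×
                        (∀ v → IsArch v → IsSource v → toℕ v ≡ 0)

Good : (n : ℕ) → Vec (Fin (2 ℕ.* n)) (2 ℕ.* n) × Vec (Vec Bool (2 ℕ.* n)) (2 ℕ.* n) → Set
Good n (σ , r) = IsMatching σ × IsConnected σ × IsOrientation σ r
                 × IsAcyclic σ r × UniqueSourceAtOne σ r

{-# OPTIONS --safe #-}

-- With κ the exponential generating function of the k̃, and M the series inside the logarithm,
-- κ′ M = −M′, which determines κ. Up to sign, the coefficients of M count the noncrossing
-- matchings, so the same equation for the counts of the pairs (σ, r) says that the signed number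
-- of ways to split 2n points into the points of a pair (σ, r), among them 1, and the points of a
-- noncrossing matching equals minus the signed number of noncrossing matchings of 2n points.
-- Joining the two parts, and orienting every new edge of the crossing graph towards the
-- noncrossing part, gives a matching with an acyclic orientation in which some sinks are marked,
-- among them every source other than the arch of 1. If there is an arc, then some sink is not a
-- source, and changing its mark reverses the sign. Only the configurations without arcs remain:
-- noncrossing matchings, all of whose arches except that of 1 are marked.

module Submission where

-- The equation for the counts involves only derivatives: the point 1 is set aside and the other
-- points are distributed freely over the two parts. Hence the product of exponential generating
-- functions is organised by two-colourings of points, with odd sizes included. The sign of a
-- noncrossing part is `ε` of its number of points: for an even number it is -1 to the number of
-- arches, and it vanishes at odd numbers, as the coefficients of M do. Each condition on the marks
-- serves the cutting. Marked arches are sinks, so the direction of every arc between the parts is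
-- forced. A source other than the arch of 1 is marked, since unmarked it would remain a second
-- source of its part. A sink that is not a source escapes both conditions, and this freedom is what
-- cancels; an arch without arcs is both, so its mark is forced. Connectedness is never tracked
-- through cutting and joining, because the unique source implies it. The Catalan numbers are
-- reached through ballot numbers, since removing the leftmost point of a noncrossing matching
-- leaves its partner with an open end.

-- Sums over finite types and their reindexing

module FiniteSums where

  open import Defs using (sumℚ)
  open import Data.Bool using (Bool; true; false; if_then_else_)
  import Data.Bool.Properties as Bool
  open import Data.Fin using (Fin)
  import Data.Fin.Properties as Fin
  import Data.Integer as ℤ
  import Data.Integer.Properties as ℤ
  open import Data.List using (List; []; _∷_; _++_; map; length; filter; cartesianProductWith; cartesianProduct; allFin)
  open import Data.List.Membership.Propositional using (_∈_)
  open import Data.List.Membership.Propositional.Properties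
    using (∈-allFin; ∈-cartesianProductWith⁺; ∈-map⁺)
  open import Data.List.Relation.Unary.All using (All; []; _∷_)
  open import Data.List.Relation.Unary.AllPairs using ([]; _∷_)
  open import Data.List.Relation.Unary.Any using (here; there)
  open import Data.List.Relation.Unary.Unique.Propositional using (Unique)
  open import Data.List.Relation.Unary.Unique.Propositional.Properties
    using (allFin⁺; cartesianProductWith⁺; map⁺; Unique[x∷xs]⇒x∉xs)
  open import Data.Maybe using (Maybe; nothing; just)
  import Data.Maybe.Properties as Maybe
  open import Data.Nat as ℕ using (ℕ; zero; suc)
  import Data.Nat.Properties as ℕ
  open import Data.Product using (_×_; _,_; proj₁; proj₂)
  open import Data.Product.Properties using (≡-dec; ,-injective)
  open import Data.Rational as ℚ using (ℚ; fromℚᵘ; 0ℚ; 1ℚ; _+_; _*_; -_; _/_)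
  open import Data.Rational.Properties
  open import Data.Rational.Unnormalised as ℚᵘ using (mkℚᵘ; *≡*)
  import Data.Rational.Unnormalised.Properties as ℚᵘ
  open import Data.Rational.Solver using (module +-*-Solver)
  open import Data.Vec using (Vec; []; _∷_)
  import Data.Vec.Properties as Vec
  open import Function using (_∘_; mk⇔)
  open import Relation.Binary.Definitions using (DecidableEquality)
  open import Relation.Binary.PropositionalEquality
  open import Relation.Nullary using (Dec; yes; no; ¬_; does)
  open import Relation.Nullary.Decidable using (_×-dec_; dec-true; dec-false; does-⇔)

  private variable
    A B : Set
    P Q : Set

  -- Sums that count need each element listed exactly once; the same list, filtered, is the witness
  -- in the theorem.
  record Finite (A : Set) : Set where
    field
      enum     : List A
      unique   : Unique enum
      complete : ∀ x → x ∈ enum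
      _≟ᶠ_     : DecidableEquality A

  open Finite {{...}} public

  instance
    finite-Bool : Finite Bool
    finite-Bool = record
      { enum = false ∷ true ∷ []
      ; unique = ((λ ()) ∷ []) ∷ [] ∷ []
      ; complete = λ { false → here refl ; true → there (here refl) }
      ; _≟ᶠ_ = Bool._≟_ }

    finite-Fin : ∀ {n} → Finite (Fin n)
    finite-Fin {n} = record
      { enum = allFin n ; unique = allFin⁺ n ; complete = ∈-allFin ; _≟ᶠ_ = Fin._≟_ }

    finite-× : {{Finite A}} → {{Finite B}} → Finite (A × B)
    finite-× = record
      { enum = cartesianProduct enum enum
      ; unique = cartesianProductWith⁺ _,_ ,-injective unique unique
      ; complete = λ (x , y) → ∈-cartesianProductWith⁺ _,_ (complete x) (complete y)
      ; _≟ᶠ_ = ≡-dec _≟ᶠ_ _≟ᶠ_ }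

    finite-Maybe : {{Finite A}} → Finite (Maybe A)
    finite-Maybe = record
      { enum = nothing ∷ map just enum
      ; unique = nothing∉ enum ∷ map⁺ Maybe.just-injective unique
      ; complete = λ { nothing → here refl ; (just x) → there (∈-map⁺ just (complete x)) }
      ; _≟ᶠ_ = Maybe.≡-dec _≟ᶠ_ }
      where
      nothing∉ : (xs : List A) → All (nothing ≢_) (map just xs)
      nothing∉ [] = []
      nothing∉ (x ∷ xs) = (λ ()) ∷ nothing∉ xs

    finite-Vec : {{Finite A}} → ∀ {n} → Finite (Vec A n)
    finite-Vec {A} {n} = record
      { enum = vecs n ; unique = vecs-unique n ; complete = vecs-complete
      ; _≟ᶠ_ = Vec.≡-dec _≟ᶠ_ }
      where
      vecs : ∀ n → List (Vec A n)
      vecs zero    = [] ∷ []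
      vecs (suc n) = cartesianProductWith _∷_ enum (vecs n)
      vecs-unique : ∀ n → Unique (vecs n)
      vecs-unique zero    = [] ∷ []
      vecs-unique (suc n) = cartesianProductWith⁺ _∷_ Vec.∷-injective unique (vecs-unique n)
      vecs-complete : ∀ {n} (v : Vec A n) → v ∈ vecs n
      vecs-complete []      = here refl
      vecs-complete (x ∷ v) = ∈-cartesianProductWith⁺ _∷_ (complete x) (vecs-complete v)

  -- The Iverson bracket. Counts are rational from the start, so that they can carry signs and be
  -- compared with coefficients of series.
  ⟦_⟧ : Dec P → ℚ
  ⟦ d ⟧ = if does d then 1ℚ else 0ℚ

  ⟦⟧-yes : (d : Dec P) → P → ⟦ d ⟧ ≡ 1ℚ
  ⟦⟧-yes d p = cong (if_then 1ℚ else 0ℚ) (dec-true d p)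

  ⟦⟧-no : (d : Dec P) → ¬ P → ⟦ d ⟧ ≡ 0ℚ
  ⟦⟧-no d ¬p = cong (if_then 1ℚ else 0ℚ) (dec-false d ¬p)

  ⟦⟧-cong : (d : Dec P) (e : Dec Q) → (P → Q) → (Q → P) → ⟦ d ⟧ ≡ ⟦ e ⟧
  ⟦⟧-cong d e f g = cong (if_then 1ℚ else 0ℚ) (does-⇔ (mk⇔ f g) d e)

  ⟦⟧-× : (d : Dec P) (e : Dec Q) → ⟦ d ×-dec e ⟧ ≡ ⟦ d ⟧ * ⟦ e ⟧
  ⟦⟧-× (no _)  e       = sym (*-zeroˡ ⟦ e ⟧)
  ⟦⟧-× (yes _) e       = sym (*-identityˡ ⟦ e ⟧)

  sum-over : List A → (A → ℚ) → ℚ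
  sum-over []       f = 0ℚ
  sum-over (x ∷ xs) f = f x + sum-over xs f

  sumℚ-map : ∀ (f : A → ℚ) xs → sumℚ (map f xs) ≡ sum-over xs f
  sumℚ-map f []       = refl
  sumℚ-map f (x ∷ xs) = cong (f x +_) (sumℚ-map f xs)

  sum-over-cong : ∀ (xs : List A) {f g : A → ℚ} → (∀ x → f x ≡ g x) → sum-over xs f ≡ sum-over xs g
  sum-over-cong []       f≗g = refl
  sum-over-cong (x ∷ xs) f≗g = cong₂ _+_ (f≗g x) (sum-over-cong xs f≗g)

  sum-over-+ : ∀ (xs : List A) (f g : A → ℚ) →
               sum-over xs (λ x → f x + g x) ≡ sum-over xs f + sum-over xs g
  sum-over-+ []       f g = refl
  sum-over-+ (x ∷ xs) f g = trans (cong (f x + g x +_) (sum-over-+ xs f g))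
    (solve 4 (λ a b c d → (a :+ b) :+ (c :+ d) := (a :+ c) :+ (b :+ d)) refl (f x) (g x) (sum-over xs f) (sum-over xs g))
    where open +-*-Solver using (solve; _:=_; _:+_)

  sum-over-*ˡ : ∀ (xs : List A) (c : ℚ) (f : A → ℚ) →
                sum-over xs (λ x → c * f x) ≡ c * sum-over xs f
  sum-over-*ˡ []       c f = sym (*-zeroʳ c)
  sum-over-*ˡ (x ∷ xs) c f = trans (cong (c * f x +_) (sum-over-*ˡ xs c f)) (sym (*-distribˡ-+ c (f x) (sum-over xs f)))

  sum-over-0 : ∀ (xs : List A) {f : A → ℚ} → (∀ x → x ∈ xs → f x ≡ 0ℚ) → sum-over xs f ≡ 0ℚ
  sum-over-0 []       f≡0 = refl
  sum-over-0 (x ∷ xs) f≡0 = cong₂ _+_ (f≡0 x (here refl)) (sum-over-0 xs (λ y → f≡0 y ∘ there))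

  sum-over-swap : ∀ (xs : List A) (ys : List B) (f : A → B → ℚ) →
    sum-over xs (λ x → sum-over ys (f x)) ≡ sum-over ys (λ y → sum-over xs (λ x → f x y))
  sum-over-swap []       ys f = sym (sum-over-0 ys (λ _ _ → refl))
  sum-over-swap (x ∷ xs) ys f = trans (cong (sum-over ys (f x) +_) (sum-over-swap xs ys f))
                                      (sym (sum-over-+ ys (f x) (λ y → sum-over xs (λ z → f z y))))

  sum-over-++ : ∀ (xs ys : List A) (f : A → ℚ) →
                sum-over (xs ++ ys) f ≡ sum-over xs f + sum-over ys f
  sum-over-++ []       ys f = sym (+-identityˡ _)
  sum-over-++ (x ∷ xs) ys f = trans (cong (f x +_) (sum-over-++ xs ys f)) (sym (+-assoc (f x) (sum-over xs f) (sum-over ys f)))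

  sum-over-map : ∀ (h : A → B) (xs : List A) (f : B → ℚ) → sum-over (map h xs) f ≡ sum-over xs (f ∘ h)
  sum-over-map h []       f = refl
  sum-over-map h (x ∷ xs) f = cong (f (h x) +_) (sum-over-map h xs f)

  sum-over-product : ∀ {C : Set} (h : A → B → C) (xs : List A) (ys : List B) (f : C → ℚ) →
    sum-over (cartesianProductWith h xs ys) f ≡ sum-over xs (λ x → sum-over ys (λ y → f (h x y)))
  sum-over-product h []       ys f = refl
  sum-over-product h (x ∷ xs) ys f = trans (sum-over-++ (map (h x) ys) _ f)
    (cong₂ _+_ (sum-over-map (h x) ys f) (sum-over-product h xs ys f))

  module _ {{_ : Finite A}} where

    sum-over-δ : ∀ {xs : List A} → Unique xs → ∀ {a} → a ∈ xs → (f : A → ℚ) →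
                 sum-over xs (λ x → ⟦ x ≟ᶠ a ⟧ * f x) ≡ f a
    sum-over-δ {x ∷ xs} u@(_ ∷ _) {a} (here refl) f = begin
      ⟦ x ≟ᶠ x ⟧ * f x + sum-over xs (λ y → ⟦ y ≟ᶠ x ⟧ * f y)
        ≡⟨ cong₂ (λ d s → d * f x + s) (⟦⟧-yes (x ≟ᶠ x) refl) (sum-over-0 xs rest) ⟩
      1ℚ * f x + 0ℚ  ≡⟨ trans (+-identityʳ _) (*-identityˡ _) ⟩
      f x ∎
      where
      open ≡-Reasoning
      rest : ∀ y → y ∈ xs → ⟦ y ≟ᶠ x ⟧ * f y ≡ 0ℚ
      rest y y∈ = trans (cong (_* f y) (⟦⟧-no (y ≟ᶠ x) λ { refl → Unique[x∷xs]⇒x∉xs u y∈ })) (*-zeroˡ (f y))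
    sum-over-δ {x ∷ xs} u@(_ ∷ u′) {a} (there a∈) f = begin
      ⟦ x ≟ᶠ a ⟧ * f x + sum-over xs (λ y → ⟦ y ≟ᶠ a ⟧ * f y)
        ≡⟨ cong₂ (λ d s → d * f x + s)
                 (⟦⟧-no (x ≟ᶠ a) λ { refl → Unique[x∷xs]⇒x∉xs u a∈ }) (sum-over-δ u′ a∈ f) ⟩
      0ℚ * f x + f a  ≡⟨ trans (cong (_+ f a) (*-zeroˡ (f x))) (+-identityˡ _) ⟩
      f a ∎
      where open ≡-Reasoning

  ∑ : {{Finite A}} → (A → ℚ) → ℚ
  ∑ f = sum-over enum f

  module _ {{_ : Finite A}} where

    ∑-cong : {f g : A → ℚ} → (∀ x → f x ≡ g x) → ∑ f ≡ ∑ g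
    ∑-cong = sum-over-cong enum

    ∑-+ : (f g : A → ℚ) → ∑ (λ x → f x + g x) ≡ ∑ f + ∑ g
    ∑-+ = sum-over-+ enum

    ∑-*ˡ : (c : ℚ) (f : A → ℚ) → ∑ (λ x → c * f x) ≡ c * ∑ f
    ∑-*ˡ = sum-over-*ˡ enum

    ∑-0 : {f : A → ℚ} → (∀ x → f x ≡ 0ℚ) → ∑ f ≡ 0ℚ
    ∑-0 f≡0 = sum-over-0 enum (λ x _ → f≡0 x)

    ∑-δ : (a : A) (f : A → ℚ) → ∑ (λ x → ⟦ x ≟ᶠ a ⟧ * f x) ≡ f a
    ∑-δ a = sum-over-δ unique (complete a)

    ∑-unique : {P : A → Set} (P? : ∀ x → Dec (P x)) (f : A → ℚ) (a : A) →
               P a → (∀ x → P x → x ≡ a) → ∑ (λ x → ⟦ P? x ⟧ * f x) ≡ f a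
    ∑-unique {P} P? f a pa only-a = trans
      (∑-cong λ x → cong (_* f x) (⟦⟧-cong (P? x) (x ≟ᶠ a) (only-a x) λ { refl → pa }))
      (∑-δ a f)

  module _ {{_ : Finite A}} {{_ : Finite B}} where

    ∑-swap : (f : A → B → ℚ) → ∑ (λ x → ∑ (f x)) ≡ ∑ (λ y → ∑ (λ x → f x y))
    ∑-swap = sum-over-swap enum enum

    ∑-× : (f : A → ℚ) (g : B → ℚ) → ∑ (λ (x , y) → f x * g y) ≡ ∑ f * ∑ g
    ∑-× f g = begin
      ∑ (λ (x , y) → f x * g y)      ≡⟨ sum-over-product {A = A} {B = B} _,_ enum enum (λ (x , y) → f x * g y) ⟩
      ∑ (λ x → ∑ (λ y → f x * g y))  ≡⟨ ∑-cong (λ x → trans (∑-*ˡ (f x) g) (*-comm (f x) (∑ g))) ⟩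
      ∑ (λ x → ∑ g * f x)            ≡⟨ trans (∑-*ˡ (∑ g) f) (*-comm (∑ g) (∑ f)) ⟩
      ∑ f * ∑ g ∎
      where open ≡-Reasoning

    -- Both sides count the graph of the correspondence f, g.
    ∑-bijection : {P : A → Set} {Q : B → Set} (P? : ∀ x → Dec (P x)) (Q? : ∀ y → Dec (Q y))
      (f : A → B) (g : B → A) →
      (∀ x → P x → Q (f x) × g (f x) ≡ x) → (∀ y → Q y → P (g y) × f (g y) ≡ y) →
      ∑ (λ x → ⟦ P? x ⟧) ≡ ∑ (λ y → ⟦ Q? y ⟧)
    ∑-bijection P? Q? f g to from = begin
      ∑ (λ x → ⟦ P? x ⟧)
        ≡⟨ ∑-cong (λ x → sym (∑-δ (f x) (λ _ → ⟦ P? x ⟧))) ⟩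
      ∑ (λ x → ∑ (λ y → ⟦ y ≟ᶠ f x ⟧ * ⟦ P? x ⟧))
        ≡⟨ ∑-swap _ ⟩
      ∑ (λ y → ∑ (λ x → ⟦ y ≟ᶠ f x ⟧ * ⟦ P? x ⟧))
        ≡⟨ ∑-cong (λ y → ∑-cong (λ x → graph x y)) ⟩
      ∑ (λ y → ∑ (λ x → ⟦ x ≟ᶠ g y ⟧ * ⟦ Q? y ⟧))
        ≡⟨ ∑-cong (λ y → ∑-δ (g y) (λ _ → ⟦ Q? y ⟧)) ⟩
      ∑ (λ y → ⟦ Q? y ⟧) ∎
      where
      open ≡-Reasoning
      graph : ∀ x y → ⟦ y ≟ᶠ f x ⟧ * ⟦ P? x ⟧ ≡ ⟦ x ≟ᶠ g y ⟧ * ⟦ Q? y ⟧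
      graph x y = trans (sym (⟦⟧-× (y ≟ᶠ f x) (P? x))) (trans
        (⟦⟧-cong ((y ≟ᶠ f x) ×-dec P? x) ((x ≟ᶠ g y) ×-dec Q? y)
          (λ { (refl , p) → sym (proj₂ (to x p)) , proj₁ (to x p) })
          (λ { (refl , q) → sym (proj₂ (from y q)) , proj₁ (from y q) }))
        (⟦⟧-× (x ≟ᶠ g y) (Q? y)))

  self-negative⇒0 : ∀ p → p ≡ - p → p ≡ 0ℚ
  self-negative⇒0 p p≡-p = begin
    p                     ≡⟨ solve 1 (λ x → x := con ℚ.½ :* (x :+ x)) refl p ⟩
    ℚ.½ * (p + p)         ≡⟨ cong (λ q → ℚ.½ * (p + q)) p≡-p ⟩
    ℚ.½ * (p + - p)       ≡⟨ solve 1 (λ x → con ℚ.½ :* (x :+ :- x) := con 0ℚ) refl p ⟩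
    0ℚ ∎
    where
    open ≡-Reasoning
    open +-*-Solver using (solve; _:=_; _:+_; _:*_; :-_; con)

  -- Reindexing along `φ` turns the sum into its negative. At a fixed point of `φ` the oddness of
  -- `f` itself forces the value 0.
  ∑-involution : {{_ : Finite A}} (φ : A → A) (f : A → ℚ) →
                 (∀ x → φ (φ x) ≡ x) → (∀ x → f (φ x) ≡ - f x) → ∑ f ≡ 0ℚ
  ∑-involution φ f φφ f-odd = self-negative⇒0 (∑ f) (begin
    ∑ f                                      ≡⟨ ∑-cong (λ x → sym (∑-δ (φ x) (λ _ → f x))) ⟩
    ∑ (λ x → ∑ (λ y → ⟦ y ≟ᶠ φ x ⟧ * f x))   ≡⟨ ∑-swap (λ x y → ⟦ y ≟ᶠ φ x ⟧ * f x) ⟩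
    ∑ (λ y → ∑ (λ x → ⟦ y ≟ᶠ φ x ⟧ * f x))
      ≡⟨ ∑-cong (λ y → ∑-cong (λ x → cong (_* f x) (⟦⟧-cong (y ≟ᶠ φ x) (x ≟ᶠ φ y)
           (λ { refl → sym (φφ x) }) (λ { refl → sym (φφ y) })))) ⟩
    ∑ (λ y → ∑ (λ x → ⟦ x ≟ᶠ φ y ⟧ * f x))   ≡⟨ ∑-cong (λ y → ∑-δ (φ y) f) ⟩
    ∑ (λ y → f (φ y))                        ≡⟨ ∑-cong f-odd ⟩
    ∑ (λ y → - f y)                          ≡⟨ ∑-cong (λ y → solve 1 (λ x → :- x := con (- 1ℚ) :* x) refl (f y)) ⟩
    ∑ (λ y → - 1ℚ * f y)                     ≡⟨ ∑-*ˡ (- 1ℚ) f ⟩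
    - 1ℚ * ∑ f                               ≡⟨ solve 1 (λ x → con (- 1ℚ) :* x := :- x) refl (∑ f) ⟩
    - ∑ f ∎)
    where
    open ≡-Reasoning
    open +-*-Solver using (solve; _:=_; _:+_; _:*_; :-_; con)

  fromℚᵘ-homo-+ : ∀ p q → fromℚᵘ (p ℚᵘ.+ q) ≡ fromℚᵘ p + fromℚᵘ q
  fromℚᵘ-homo-+ p q = toℚᵘ-injective (ℚᵘ.≃-trans (toℚᵘ-fromℚᵘ (p ℚᵘ.+ q)) (ℚᵘ.≃-sym
    (ℚᵘ.≃-trans (toℚᵘ-homo-+ (fromℚᵘ p) (fromℚᵘ q)) (ℚᵘ.+-cong (toℚᵘ-fromℚᵘ p) (toℚᵘ-fromℚᵘ q)))))

  fromℚᵘ-homo-* : ∀ p q → fromℚᵘ (p ℚᵘ.* q) ≡ fromℚᵘ p * fromℚᵘ q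
  fromℚᵘ-homo-* p q = toℚᵘ-injective (ℚᵘ.≃-trans (toℚᵘ-fromℚᵘ (p ℚᵘ.* q)) (ℚᵘ.≃-sym
    (ℚᵘ.≃-trans (toℚᵘ-homo-* (fromℚᵘ p) (fromℚᵘ q)) (ℚᵘ.*-cong (toℚᵘ-fromℚᵘ p) (toℚᵘ-fromℚᵘ q)))))

  opaque
    -- Opaque, so that the normalisation of fractions inside `_/_` stays folded; outside this block
    -- only the laws below are available.
    fromℕ : ℕ → ℚ
    fromℕ n = ℤ.+ n / 1

    fromℕ-/ : ∀ n → fromℕ n ≡ ℤ.+ n / 1
    fromℕ-/ n = refl

    fromℕ-0 : fromℕ 0 ≡ 0ℚ
    fromℕ-0 = refl

    fromℕ-1 : fromℕ 1 ≡ 1ℚ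
    fromℕ-1 = refl

    fromℕ-+ : ∀ m n → fromℕ (m ℕ.+ n) ≡ fromℕ m + fromℕ n
    fromℕ-+ m n = trans
      (cong (_/ 1) (sym (cong₂ ℤ._+_ (ℤ.*-identityʳ (ℤ.+ m)) (ℤ.*-identityʳ (ℤ.+ n)))))
      (fromℚᵘ-homo-+ (mkℚᵘ (ℤ.+ m) 0) (mkℚᵘ (ℤ.+ n) 0))

    fromℕ-* : ∀ m n → fromℕ (m ℕ.* n) ≡ fromℕ m * fromℕ n
    fromℕ-* m n = trans (cong (_/ 1) (ℤ.pos-* m n)) (fromℚᵘ-homo-* (mkℚᵘ (ℤ.+ m) 0) (mkℚᵘ (ℤ.+ n) 0))

    fromℕ-*-/ : ∀ m n → fromℕ (suc n) * (ℤ.+ m / suc n) ≡ fromℕ m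
    fromℕ-*-/ m n = trans (sym (fromℚᵘ-homo-* (mkℚᵘ (ℤ.+ suc n) 0) (mkℚᵘ (ℤ.+ m) n)))
      (fromℚᵘ-cong {mkℚᵘ (ℤ.+ suc n) 0 ℚᵘ.* mkℚᵘ (ℤ.+ m) n} {mkℚᵘ (ℤ.+ m) 0} (*≡* (trans (ℤ.*-identityʳ (ℤ.+ suc n ℤ.* ℤ.+ m)) (trans (ℤ.*-comm (ℤ.+ suc n) (ℤ.+ m))
        (cong (λ k → ℤ.+ m ℤ.* ℤ.+ suc k) (sym (ℕ.+-identityʳ n)))))))

  fromℕ-suc : ∀ n → fromℕ (suc n) ≡ 1ℚ + fromℕ n
  fromℕ-suc n = trans (fromℕ-+ 1 n) (cong (_+ fromℕ n) fromℕ-1)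

  length-filter : {P : A → Set} (P? : ∀ x → Dec (P x)) (xs : List A) →
                  fromℕ (length (filter P? xs)) ≡ sum-over xs (λ x → ⟦ P? x ⟧)
  length-filter P? [] = fromℕ-0
  length-filter P? (x ∷ xs) with P? x
  ... | yes _ = trans (fromℕ-suc (length (filter P? xs))) (cong (1ℚ +_) (length-filter P? xs))
  ... | no  _ = trans (length-filter P? xs) (sym (+-identityˡ _))

-- Exponential generating functions as sequences under the Leibniz product

module ShuffleProduct where

  open import Defs using (Series; oneS)
  open FiniteSums
  open import Data.Bool using (Bool; true; false)
  open import Data.Nat as ℕ using (ℕ; zero; suc; z≤n; s≤s)
  import Data.Nat.Properties as ℕ
  open import Data.Nat.Induction using (<-rec)
  open import Data.Rational using (ℚ; 0ℚ; 1ℚ; _+_; _*_; -_)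
  open import Data.Rational.Properties
  open import Data.Rational.Solver using (module +-*-Solver)
  open import Data.Vec using (Vec; []; _∷_)
  open import Relation.Binary.PropositionalEquality
  open +-*-Solver using (solve; _:=_; _:+_; _:*_; :-_; con)
  open ≡-Reasoning

  -- For coefficients taken with respect to z^m / m!, the shift is the derivative.
  D : Series → Series
  D a m = a (suc m)

  infixl 7 _⊗_
  infixl 6 _⊕_
  infixr 7 _⊙_

  _⊕_ : Series → Series → Series
  (a ⊕ b) m = a m + b m

  _⊙_ : ℚ → Series → Series
  (c ⊙ a) m = c * a m

  -- The product of exponential generating functions, a and b being the sequences of
  -- coefficients of z^m / m!; the recursion is the Leibniz rule.
  _⊗_ : Series → Series → Series
  (a ⊗ b) zero    = a 0 * b 0
  (a ⊗ b) (suc m) = (D a ⊗ b) m + (a ⊗ D b) m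

  ⊗-cong : ∀ {a a′ b b′} → a ≗ a′ → b ≗ b′ → a ⊗ b ≗ a′ ⊗ b′
  ⊗-cong p q zero    = cong₂ _*_ (p 0) (q 0)
  ⊗-cong p q (suc m) = cong₂ _+_ (⊗-cong (λ i → p (suc i)) q m) (⊗-cong p (λ i → q (suc i)) m)

  ⊗-comm : ∀ a b → a ⊗ b ≗ b ⊗ a
  ⊗-comm a b zero    = *-comm (a 0) (b 0)
  ⊗-comm a b (suc m) = trans (cong₂ _+_ (⊗-comm (D a) b m) (⊗-comm a (D b) m))
                             (+-comm ((b ⊗ D a) m) ((D b ⊗ a) m))

  ⊗-distribʳ : ∀ a b c → (a ⊕ b) ⊗ c ≗ a ⊗ c ⊕ b ⊗ c
  ⊗-distribʳ a b c zero    = *-distribʳ-+ (c 0) (a 0) (b 0)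
  ⊗-distribʳ a b c (suc m) = trans
    (cong₂ _+_ (⊗-distribʳ (D a) (D b) c m) (⊗-distribʳ a b (D c) m))
    (solve 4 (λ p q r s → (p :+ q) :+ (r :+ s) := (p :+ r) :+ (q :+ s)) refl
       ((D a ⊗ c) m) ((D b ⊗ c) m) ((a ⊗ D c) m) ((b ⊗ D c) m))

  ⊗-distribˡ : ∀ a b c → a ⊗ (b ⊕ c) ≗ a ⊗ b ⊕ a ⊗ c
  ⊗-distribˡ a b c m = trans (⊗-comm a (b ⊕ c) m) (trans (⊗-distribʳ b c a m)
    (cong₂ _+_ (⊗-comm b a m) (⊗-comm c a m)))

  ⊗-⊙ˡ : ∀ k a b → (k ⊙ a) ⊗ b ≗ k ⊙ (a ⊗ b)
  ⊗-⊙ˡ k a b zero    = *-assoc k (a 0) (b 0)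
  ⊗-⊙ˡ k a b (suc m) = trans (cong₂ _+_ (⊗-⊙ˡ k (D a) b m) (⊗-⊙ˡ k a (D b) m))
                             (sym (*-distribˡ-+ k ((D a ⊗ b) m) ((a ⊗ D b) m)))

  ⊗-⊙ʳ : ∀ k a b → a ⊗ (k ⊙ b) ≗ k ⊙ (a ⊗ b)
  ⊗-⊙ʳ k a b m = trans (⊗-comm a (k ⊙ b) m)
    (trans (⊗-⊙ˡ k b a m) (cong (k *_) (⊗-comm b a m)))

  ⊗-assoc : ∀ a b c → (a ⊗ b) ⊗ c ≗ a ⊗ (b ⊗ c)
  ⊗-assoc a b c zero    = *-assoc (a 0) (b 0) (c 0)
  ⊗-assoc a b c (suc m) = begin
    (((D a ⊗ b) ⊕ (a ⊗ D b)) ⊗ c) m + ((a ⊗ b) ⊗ D c) m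
      ≡⟨ cong (_+ ((a ⊗ b) ⊗ D c) m) (⊗-distribʳ (D a ⊗ b) (a ⊗ D b) c m) ⟩
    ((D a ⊗ b) ⊗ c) m + ((a ⊗ D b) ⊗ c) m + ((a ⊗ b) ⊗ D c) m
      ≡⟨ cong₂ _+_ (cong₂ _+_ (⊗-assoc (D a) b c m) (⊗-assoc a (D b) c m)) (⊗-assoc a b (D c) m) ⟩
    (D a ⊗ (b ⊗ c)) m + (a ⊗ (D b ⊗ c)) m + (a ⊗ (b ⊗ D c)) m
      ≡⟨ +-assoc ((D a ⊗ (b ⊗ c)) m) ((a ⊗ (D b ⊗ c)) m) ((a ⊗ (b ⊗ D c)) m) ⟩
    (D a ⊗ (b ⊗ c)) m + ((a ⊗ (D b ⊗ c)) m + (a ⊗ (b ⊗ D c)) m)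
      ≡⟨ cong ((D a ⊗ (b ⊗ c)) m +_) (⊗-distribˡ a (D b ⊗ c) (b ⊗ D c) m) ⟨
    (D a ⊗ (b ⊗ c)) m + (a ⊗ ((D b ⊗ c) ⊕ (b ⊗ D c))) m ∎

  ⊗-vanish : ∀ a b m → (∀ j → j ℕ.≤ m → a j ≡ 0ℚ) → (a ⊗ b) m ≡ 0ℚ
  ⊗-vanish a b zero    a≡0 = trans (cong (_* b 0) (a≡0 0 z≤n)) (*-zeroˡ (b 0))
  ⊗-vanish a b (suc m) a≡0 = cong₂ _+_
    (⊗-vanish (D a) b m (λ j j≤m → a≡0 (suc j) (s≤s j≤m)))
    (⊗-vanish a (D b) m (λ j j≤m → a≡0 j (ℕ.m≤n⇒m≤1+n j≤m)))

  -- In the Leibniz expansion, every summand except the one where all derivatives fall on `a`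
  -- contains a coefficient of `a` of index below `m`.
  ⊗-leading : ∀ a b m → (∀ j → j ℕ.< m → a j ≡ 0ℚ) → (a ⊗ b) m ≡ a m * b 0
  ⊗-leading a b zero    a≡0 = refl
  ⊗-leading a b (suc m) a≡0 = trans
    (cong₂ _+_ (⊗-leading (D a) b m (λ j j<m → a≡0 (suc j) (s≤s j<m)))
               (⊗-vanish a (D b) m (λ j j≤m → a≡0 j (s≤s j≤m))))
    (+-identityʳ (a (suc m) * b 0))

  ⊗-identityˡ : ∀ a → oneS ⊗ a ≗ a
  ⊗-identityˡ a zero    = *-identityˡ (a 0)
  ⊗-identityˡ a (suc m) = trans
    (cong₂ _+_ (⊗-vanish (D oneS) a m (λ _ _ → refl)) (⊗-identityˡ (D a) m)) (+-identityˡ (a (suc m)))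

  -- Differences are written with the factor `- 1ℚ` so that the linearity laws for `_⊕_` and `_⊙_`
  -- apply to them.
  difference-0 : ∀ x y → x + - 1ℚ * y ≡ 0ℚ → x ≡ y
  difference-0 x y eq = begin
    x                        ≡⟨ solve 2 (λ x y → x := (x :+ con (- 1ℚ) :* y) :+ y) refl x y ⟩
    (x + - 1ℚ * y) + y       ≡⟨ cong (_+ y) eq ⟩
    0ℚ + y                   ≡⟨ +-identityˡ y ⟩
    y ∎

  ⊗-difference : ∀ a a′ b → (a ⊕ (- 1ℚ) ⊙ a′) ⊗ b ≗ a ⊗ b ⊕ (- 1ℚ) ⊙ (a′ ⊗ b)
  ⊗-difference a a′ b m = trans (⊗-distribʳ a ((- 1ℚ) ⊙ a′) b m)
                                (cong ((a ⊗ b) m +_) (⊗-⊙ˡ (- 1ℚ) a′ b m))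

  self-difference : ∀ x → x + - 1ℚ * x ≡ 0ℚ
  self-difference = solve 1 (λ x → x :+ con (- 1ℚ) :* x := con 0ℚ) refl

  -- Linearity reduces this to `⊗-vanish` for the difference. It lets a series be replaced by a
  -- truncation chosen for one coefficient.
  ⊗-cong-≤ : ∀ a a′ b m → (∀ j → j ℕ.≤ m → a j ≡ a′ j) → (a ⊗ b) m ≡ (a′ ⊗ b) m
  ⊗-cong-≤ a a′ b m eq = difference-0 ((a ⊗ b) m) ((a′ ⊗ b) m) (trans (sym (⊗-difference a a′ b m))
    (⊗-vanish (a ⊕ (- 1ℚ) ⊙ a′) b m λ j j≤m →
      trans (cong (λ x → x + - 1ℚ * a′ j) (eq j j≤m)) (self-difference (a′ j))))

  -- By strong induction: the first nonzero coefficient of the difference would survive in the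
  -- product, multiplied by `b 0`.
  ⊗-cancelʳ : ∀ a a′ b → b 0 ≡ 1ℚ → a ⊗ b ≗ a′ ⊗ b → a ≗ a′
  ⊗-cancelʳ a a′ b b₀≡1 eq m = difference-0 (a m) (a′ m) (<-rec (λ m → d m ≡ 0ℚ) step m)
    where
    d = a ⊕ (- 1ℚ) ⊙ a′
    step : ∀ m → (∀ {j} → j ℕ.< m → d j ≡ 0ℚ) → d m ≡ 0ℚ
    step m d≡0 = begin
      d m                                  ≡⟨ *-identityʳ (d m) ⟨
      d m * 1ℚ                             ≡⟨ cong (d m *_) b₀≡1 ⟨
      d m * b 0                            ≡⟨ ⊗-leading d b m (λ _ → d≡0) ⟨
      (d ⊗ b) m                            ≡⟨ ⊗-difference a a′ b m ⟩
      (a ⊗ b) m + - 1ℚ * (a′ ⊗ b) m        ≡⟨ cong (_+ - 1ℚ * (a′ ⊗ b) m) (eq m) ⟩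
      (a′ ⊗ b) m + - 1ℚ * (a′ ⊗ b) m       ≡⟨ self-difference ((a′ ⊗ b) m) ⟩
      0ℚ ∎

  -- The clauses split on both colours, so that a head of the counted colour makes the count compute
  -- to a successor; the types of positions in the pieces rely on this.
  count : Bool → ∀ {n} → Vec Bool n → ℕ
  count k     []          = 0
  count false (false ∷ c) = suc (count false c)
  count false (true  ∷ c) = count false c
  count true  (false ∷ c) = count true c
  count true  (true  ∷ c) = suc (count true c)

  ∑-Vec-Bool-suc : ∀ {m} (f : Vec Bool (suc m) → ℚ) →
                   ∑ f ≡ ∑ (λ c → f (false ∷ c)) + ∑ (λ c → f (true ∷ c))
  ∑-Vec-Bool-suc f = trans (sum-over-product {A = Bool} {B = Vec Bool _} _∷_ enum enum f)
    (cong (∑ (λ c → f (false ∷ c)) +_) (+-identityʳ (∑ (λ c → f (true ∷ c)))))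

  -- A colouring records, for each of the `m` differentiations in the Leibniz rule, which of the two
  -- factors it hits.
  ∑-colourings : ∀ a b m → ∑ {A = Vec Bool m} (λ c → a (count false c) * b (count true c)) ≡ (a ⊗ b) m
  ∑-colourings a b zero    = +-identityʳ (a 0 * b 0)
  ∑-colourings a b (suc m) = trans (∑-Vec-Bool-suc {m} (λ c → a (count false c) * b (count true c)))
    (cong₂ _+_ (∑-colourings (D a) b m) (∑-colourings a (D b) m))

-- The differential equation of the formal logarithm

module LogSeries where

  open import Defs using (Series; oneS; _·_; _^S_; sgn; Mser; User; logM)
  open FiniteSums
  open ShuffleProduct
  import Data.Integer as ℤ
  open import Data.List using (upTo; applyUpTo)
  open import Data.Nat as ℕ using (ℕ; zero; suc; s≤s; _!)
  import Data.Nat.Properties as ℕ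
  open import Data.Rational using (ℚ; 0ℚ; 1ℚ; _+_; _*_; -_; _/_)
  open import Data.Rational.Properties
  open import Data.Rational.Solver using (module +-*-Solver)
  open import Function using (_∘_)
  open import Relation.Binary.PropositionalEquality
  open +-*-Solver using (solve; _:=_; _:+_; _:*_; :-_; con)
  open ≡-Reasoning

  sum-over-applyUpTo : ∀ (f : ℕ → ℚ) (g : ℕ → ℕ) n →
                       sum-over (applyUpTo g n) f ≡ sum-over (upTo n) (f ∘ g)
  sum-over-applyUpTo f g zero    = refl
  sum-over-applyUpTo f g (suc n) = cong (f (g 0) +_) (trans
    (sum-over-applyUpTo f (g ∘ suc) n) (sym (sum-over-applyUpTo (f ∘ g) suc n)))

  sum-over-upTo-sucˡ : ∀ (f : ℕ → ℚ) n → sum-over (upTo (suc n)) f ≡ f 0 + sum-over (upTo n) (f ∘ suc)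
  sum-over-upTo-sucˡ f n = cong (f 0 +_) (sum-over-applyUpTo f suc n)

  sum-over-upTo-sucʳ : ∀ (f : ℕ → ℚ) n → sum-over (upTo (suc n)) f ≡ sum-over (upTo n) f + f n
  sum-over-upTo-sucʳ f zero    = +-comm (f 0) 0ℚ
  sum-over-upTo-sucʳ f (suc n) = begin
    sum-over (upTo (suc (suc n))) f                      ≡⟨ sum-over-upTo-sucˡ f (suc n) ⟩
    f 0 + sum-over (upTo (suc n)) (f ∘ suc)              ≡⟨ cong (f 0 +_) (sum-over-upTo-sucʳ (f ∘ suc) n) ⟩
    f 0 + (sum-over (upTo n) (f ∘ suc) + f (suc n))      ≡⟨ +-assoc (f 0) (sum-over (upTo n) (f ∘ suc)) (f (suc n)) ⟨
    f 0 + sum-over (upTo n) (f ∘ suc) + f (suc n)        ≡⟨ cong (_+ f (suc n)) (sum-over-upTo-sucˡ f n) ⟨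
    sum-over (upTo (suc n)) f + f (suc n) ∎

  ·-zero : ∀ a b → (a · b) 0 ≡ a 0 * b 0
  ·-zero a b = +-identityʳ (a 0 * b 0)

  -- Here `D a` is the quotient of `a - a 0` by z. This recursion replaces the Cauchy sum in the
  -- inductions below.
  ·-suc : ∀ a b m → (a · b) (suc m) ≡ a 0 * b (suc m) + (D a · b) m
  ·-suc a b m = begin
    (a · b) (suc m)
      ≡⟨ sumℚ-map (λ i → a i * b (suc m ℕ.∸ i)) (upTo (suc (suc m))) ⟩
    sum-over (upTo (suc (suc m))) (λ i → a i * b (suc m ℕ.∸ i))
      ≡⟨ sum-over-upTo-sucˡ (λ i → a i * b (suc m ℕ.∸ i)) (suc m) ⟩
    a 0 * b (suc m) + sum-over (upTo (suc m)) (λ i → D a i * b (m ℕ.∸ i))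
      ≡⟨ cong (a 0 * b (suc m) +_) (sumℚ-map (λ i → D a i * b (m ℕ.∸ i)) (upTo (suc m))) ⟨
    a 0 * b (suc m) + (D a · b) m ∎

  ·-congˡ : ∀ {a a′} b → a ≗ a′ → a · b ≗ a′ · b
  ·-congˡ {a} {a′} b eq m = begin
    (a · b) m    ≡⟨ sumℚ-map (λ i → a i * b (m ℕ.∸ i)) (upTo (suc m)) ⟩
    sum-over (upTo (suc m)) (λ i → a i * b (m ℕ.∸ i))
                 ≡⟨ sum-over-cong (upTo (suc m)) (λ i → cong (_* b (m ℕ.∸ i)) (eq i)) ⟩
    sum-over (upTo (suc m)) (λ i → a′ i * b (m ℕ.∸ i))
                 ≡⟨ sumℚ-map (λ i → a′ i * b (m ℕ.∸ i)) (upTo (suc m)) ⟨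
    (a′ · b) m ∎

  ·-distribʳ : ∀ a a′ b → (a ⊕ a′) · b ≗ a · b ⊕ a′ · b
  ·-distribʳ a a′ b zero = begin
    ((a ⊕ a′) · b) 0           ≡⟨ ·-zero (a ⊕ a′) b ⟩
    (a 0 + a′ 0) * b 0         ≡⟨ *-distribʳ-+ (b 0) (a 0) (a′ 0) ⟩
    a 0 * b 0 + a′ 0 * b 0     ≡⟨ cong₂ _+_ (·-zero a b) (·-zero a′ b) ⟨
    (a · b) 0 + (a′ · b) 0 ∎
  ·-distribʳ a a′ b (suc m) = begin
    ((a ⊕ a′) · b) (suc m)
      ≡⟨ ·-suc (a ⊕ a′) b m ⟩
    (a 0 + a′ 0) * b (suc m) + ((D a ⊕ D a′) · b) m
      ≡⟨ cong ((a 0 + a′ 0) * b (suc m) +_) (·-distribʳ (D a) (D a′) b m) ⟩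
    (a 0 + a′ 0) * b (suc m) + ((D a · b) m + (D a′ · b) m)
      ≡⟨ solve 5 (λ x y z p q → (x :+ y) :* z :+ (p :+ q) := (x :* z :+ p) :+ (y :* z :+ q)) refl
           (a 0) (a′ 0) (b (suc m)) ((D a · b) m) ((D a′ · b) m) ⟩
    (a 0 * b (suc m) + (D a · b) m) + (a′ 0 * b (suc m) + (D a′ · b) m)
      ≡⟨ cong₂ _+_ (·-suc a b m) (·-suc a′ b m) ⟨
    (a · b) (suc m) + (a′ · b) (suc m) ∎

  derivative : Series → Series
  derivative a m = fromℕ (suc m) * a (suc m)

  -- The derivative of `a 0 + z D a` is `D a + z (D a)′`; shift it once.
  D-derivative : ∀ a → D (derivative a) ≗ D (D a) ⊕ derivative (D a)
  D-derivative a m = begin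
    fromℕ (suc (suc m)) * a (suc (suc m))
      ≡⟨ cong (_* a (suc (suc m))) (fromℕ-suc (suc m)) ⟩
    (1ℚ + fromℕ (suc m)) * a (suc (suc m))
      ≡⟨ solve 2 (λ n x → (con 1ℚ :+ n) :* x := x :+ n :* x) refl (fromℕ (suc m)) (a (suc (suc m))) ⟩
    a (suc (suc m)) + fromℕ (suc m) * a (suc (suc m)) ∎

  leibniz : ∀ a b → derivative (a · b) ≗ derivative a · b ⊕ a · derivative b
  leibniz a b zero = begin
    fromℕ 1 * (a · b) 1
      ≡⟨ cong (fromℕ 1 *_) (trans (·-suc a b 0) (cong (a 0 * b 1 +_) (·-zero (D a) b))) ⟩
    fromℕ 1 * (a 0 * b 1 + a 1 * b 0)
      ≡⟨ solve 5 (λ n x y z w → n :* (x :* y :+ z :* w) := (n :* z) :* w :+ x :* (n :* y)) refl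
           (fromℕ 1) (a 0) (b 1) (a 1) (b 0) ⟩
    (fromℕ 1 * a 1) * b 0 + a 0 * (fromℕ 1 * b 1)
      ≡⟨ cong₂ _+_ (·-zero (derivative a) b) (·-zero a (derivative b)) ⟨
    (derivative a · b) 0 + (a · derivative b) 0 ∎
  leibniz a b (suc m) = begin
    fromℕ (suc (suc m)) * (a · b) (suc (suc m))
      ≡⟨ cong₂ _*_ (fromℕ-suc (suc m)) (·-suc a b (suc m)) ⟩
    (1ℚ + n) * (a 0 * b (suc (suc m)) + s)
      ≡⟨ solve 4 (λ n x y s → (con 1ℚ :+ n) :* (x :* y :+ s) := s :+ n :* s :+ x :* ((con 1ℚ :+ n) :* y))
           refl n (a 0) (b (suc (suc m))) s ⟩
    s + n * s + a 0 * ((1ℚ + n) * b (suc (suc m)))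
      ≡⟨ cong₂ (λ p q → s + p + a 0 * (q * b (suc (suc m))))
               (leibniz (D a) b m) (sym (fromℕ-suc (suc m))) ⟩
    s + ((derivative (D a) · b) m + (D a · derivative b) m) + a 0 * D (derivative b) m
      ≡⟨ cong (λ p → p + ((derivative (D a) · b) m + (D a · derivative b) m) + a 0 * D (derivative b) m)
              (·-suc (D a) b m) ⟩
    a 1 * b (suc m) + (D (D a) · b) m + ((derivative (D a) · b) m + (D a · derivative b) m)
      + a 0 * D (derivative b) m
      ≡⟨ solve 5 (λ x p q r y → x :+ p :+ (q :+ r) :+ y := (x :+ (p :+ q)) :+ (y :+ r)) refl
           (a 1 * b (suc m)) ((D (D a) · b) m) ((derivative (D a) · b) m) ((D a · derivative b) m)
           (a 0 * D (derivative b) m) ⟩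
    (a 1 * b (suc m) + ((D (D a) · b) m + (derivative (D a) · b) m))
      + (a 0 * D (derivative b) m + (D a · derivative b) m)
      ≡⟨ cong₂ (λ p q → (p * b (suc m) + q) + (a 0 * D (derivative b) m + (D a · derivative b) m))
           (trans (cong (_* a 1) fromℕ-1) (*-identityˡ (a 1)))
           (trans (·-congˡ b (D-derivative a) m) (·-distribʳ (D (D a)) (derivative (D a)) b m)) ⟨
    (derivative a 0 * b (suc m) + (D (derivative a) · b) m)
      + (a 0 * D (derivative b) m + (D a · derivative b) m)
      ≡⟨ cong₂ _+_ (·-suc (derivative a) b m) (·-suc a (derivative b) m) ⟨
    (derivative a · b) (suc m) + (a · derivative b) (suc m) ∎
    where
    n = fromℕ (suc m)
    s = (D a · b) (suc m)

  -- The same power series, with its coefficients taken with respect to z^m / m!.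
  egf : Series → Series
  egf a m = fromℕ (m !) * a m

  D-egf : ∀ a → D (egf a) ≗ egf (derivative a)
  D-egf a m = trans (cong (_* a (suc m)) (fromℕ-* (suc m) (m !)))
    (solve 3 (λ x y z → (x :* y) :* z := y :* (x :* z)) refl (fromℕ (suc m)) (fromℕ (m !)) (a (suc m)))

  -- Both products obey a Leibniz rule, and `D-egf` matches the two derivations, so agreement at
  -- index 0 propagates. No binomial coefficients enter.
  egf-· : ∀ a b → egf (a · b) ≗ egf a ⊗ egf b
  egf-· a b zero = begin
    fromℕ 1 * (a · b) 0                      ≡⟨ cong₂ _*_ fromℕ-1 (·-zero a b) ⟩
    1ℚ * (a 0 * b 0)                         ≡⟨ solve 2 (λ x y → con 1ℚ :* (x :* y) := (con 1ℚ :* x) :* (con 1ℚ :* y))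
                                                  refl (a 0) (b 0) ⟩
    (1ℚ * a 0) * (1ℚ * b 0)                  ≡⟨ cong (λ n → (n * a 0) * (n * b 0)) fromℕ-1 ⟨
    (fromℕ 1 * a 0) * (fromℕ 1 * b 0) ∎
  egf-· a b (suc m) = begin
    egf (a · b) (suc m)                                        ≡⟨ D-egf (a · b) m ⟩
    fromℕ (m !) * derivative (a · b) m                         ≡⟨ cong (fromℕ (m !) *_) (leibniz a b m) ⟩
    fromℕ (m !) * ((derivative a · b) m + (a · derivative b) m)
      ≡⟨ *-distribˡ-+ (fromℕ (m !)) ((derivative a · b) m) ((a · derivative b) m) ⟩
    egf (derivative a · b) m + egf (a · derivative b) m
      ≡⟨ cong₂ _+_ (egf-· (derivative a) b m) (egf-· a (derivative b) m) ⟩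
    (egf (derivative a) ⊗ egf b) m + (egf a ⊗ egf (derivative b)) m
      ≡⟨ cong₂ _+_ (⊗-cong (D-egf a) (λ _ → refl) m) (⊗-cong (λ _ → refl) (D-egf b) m) ⟨
    (D (egf a) ⊗ egf b) m + (egf a ⊗ D (egf b)) m ∎

  infixr 8 _^⊗_

  _^⊗_ : Series → ℕ → Series
  u ^⊗ zero  = oneS
  u ^⊗ suc k = u ⊗ u ^⊗ k

  egf-^ : ∀ u k → egf (u ^S k) ≗ egf u ^⊗ k
  egf-^ u zero    zero    = trans (cong (_* 1ℚ) fromℕ-1) refl
  egf-^ u zero    (suc m) = *-zeroʳ (fromℕ (suc m !))
  egf-^ u (suc k) m       = trans (egf-· u (u ^S k) m) (⊗-cong (λ _ → refl) (egf-^ u k) m)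

  D-^ : ∀ u k → D (u ^⊗ suc k) ≗ fromℕ (suc k) ⊙ (u ^⊗ k ⊗ D u)
  D-^ u zero m = begin
    (D u ⊗ oneS) m + (u ⊗ D oneS) m
      ≡⟨ cong₂ _+_ (⊗-comm (D u) oneS m) (trans (⊗-comm u (D oneS) m) (⊗-vanish (D oneS) u m (λ _ _ → refl))) ⟩
    (oneS ⊗ D u) m + 0ℚ
      ≡⟨ solve 1 (λ x → x :+ con 0ℚ := con 1ℚ :* x) refl ((oneS ⊗ D u) m) ⟩
    1ℚ * (oneS ⊗ D u) m
      ≡⟨ cong (_* (oneS ⊗ D u) m) fromℕ-1 ⟨
    fromℕ 1 * (oneS ⊗ D u) m ∎
  D-^ u (suc k) m = begin
    (D u ⊗ v) m + (u ⊗ D v) m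
      ≡⟨ cong₂ _+_ (⊗-comm (D u) v m) (⊗-cong (λ _ → refl) (D-^ u k) m) ⟩
    (v ⊗ D u) m + (u ⊗ (n ⊙ (u ^⊗ k ⊗ D u))) m
      ≡⟨ cong ((v ⊗ D u) m +_) (⊗-⊙ʳ n u (u ^⊗ k ⊗ D u) m) ⟩
    (v ⊗ D u) m + n * (u ⊗ (u ^⊗ k ⊗ D u)) m
      ≡⟨ cong (λ x → (v ⊗ D u) m + n * x) (⊗-assoc u (u ^⊗ k) (D u) m) ⟨
    (v ⊗ D u) m + n * (v ⊗ D u) m
      ≡⟨ solve 2 (λ n x → x :+ n :* x := (con 1ℚ :+ n) :* x) refl n ((v ⊗ D u) m) ⟩
    (1ℚ + n) * (v ⊗ D u) m
      ≡⟨ cong (_* (v ⊗ D u) m) (fromℕ-suc (suc k)) ⟨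
    fromℕ (suc (suc k)) * (v ⊗ D u) m ∎
    where
    v = u ^⊗ suc k
    n = fromℕ (suc k)

  module Logarithm (u : Series) (u₀≡0 : u 0 ≡ 0ℚ) where

    -- By the power rule, coefficient `suc m` of the power `suc k` depends only on the coefficients
    -- up to `m` of the power `k` as far as that factor is concerned.
    ^-vanish : ∀ k m → m ℕ.< k → (u ^⊗ k) m ≡ 0ℚ
    ^-vanish (suc k) zero    _         = trans (cong (_* (u ^⊗ k) 0) u₀≡0) (*-zeroˡ ((u ^⊗ k) 0))
    ^-vanish (suc k) (suc m) (s≤s m<k) = trans (D-^ u k m) (trans
      (cong (fromℕ (suc k) *_) (⊗-vanish (u ^⊗ k) (D u) m (λ j j≤m → ^-vanish k j (ℕ.≤-<-trans j≤m m<k))))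
      (*-zeroʳ (fromℕ (suc k))))

    -- The derivative of the summand (-1)^k u^(k+1) / (k+1) of the logarithm.
    term : ℕ → Series
    term k = sgn k ⊙ (u ^⊗ k ⊗ D u)

    -- Partial sums of the geometric series for u′ / (1 + u).
    partial : ℕ → Series
    partial zero    _ = 0ℚ
    partial (suc K)   = partial K ⊕ term K

    term-vanish : ∀ k m → m ℕ.< k → term k m ≡ 0ℚ
    term-vanish k m m<k = trans
      (cong (sgn k *_) (⊗-vanish (u ^⊗ k) (D u) m (λ j j≤m → ^-vanish k j (ℕ.≤-<-trans j≤m m<k))))
      (*-zeroʳ (sgn k))

    partial-stable : ∀ m d → partial (d ℕ.+ suc m) m ≡ partial (suc m) m
    partial-stable m zero    = refl
    partial-stable m (suc d) = trans
      (cong₂ _+_ (partial-stable m d) (term-vanish (d ℕ.+ suc m) m (ℕ.m≤n+m (suc m) d)))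
      (+-identityʳ (partial (suc m) m))

    -- A telescoping sum.
    partial-⊗ : ∀ K → partial K ⊗ (oneS ⊕ u) ≗ D u ⊕ (- 1ℚ) ⊙ term K
    partial-⊗ zero m = begin
      (partial zero ⊗ (oneS ⊕ u)) m         ≡⟨ ⊗-vanish (partial zero) (oneS ⊕ u) m (λ _ _ → refl) ⟩
      0ℚ                                    ≡⟨ solve 1 (λ x → con 0ℚ := x :+ con (- 1ℚ) :* (con 1ℚ :* x)) refl (D u m) ⟩
      D u m + - 1ℚ * (1ℚ * D u m)
        ≡⟨ cong (λ x → D u m + - 1ℚ * (1ℚ * x)) (⊗-identityˡ (D u) m) ⟨
      D u m + - 1ℚ * (1ℚ * (oneS ⊗ D u) m) ∎
    partial-⊗ (suc K) m = begin
      ((partial K ⊕ term K) ⊗ (oneS ⊕ u)) m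
        ≡⟨ ⊗-distribʳ (partial K) (term K) (oneS ⊕ u) m ⟩
      (partial K ⊗ (oneS ⊕ u)) m + (term K ⊗ (oneS ⊕ u)) m
        ≡⟨ cong₂ _+_ (partial-⊗ K m) (⊗-⊙ˡ s X (oneS ⊕ u) m) ⟩
      D u m + - 1ℚ * (s * X m) + s * (X ⊗ (oneS ⊕ u)) m
        ≡⟨ cong (λ y → D u m + - 1ℚ * (s * X m) + s * y) (trans (⊗-distribˡ X oneS u m)
             (cong₂ _+_ (trans (⊗-comm X oneS m) (⊗-identityˡ X m))
               (trans (⊗-comm X u m) (sym (⊗-assoc u (u ^⊗ K) (D u) m))))) ⟩
      D u m + - 1ℚ * (s * X m) + s * (X m + Y m)
        ≡⟨ solve 4 (λ p s x y → p :+ con (- 1ℚ) :* (s :* x) :+ s :* (x :+ y)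
                             := p :+ con (- 1ℚ) :* ((:- s) :* y)) refl (D u m) s (X m) (Y m) ⟩
      D u m + - 1ℚ * (- s * Y m) ∎
      where
      s = sgn K
      X = u ^⊗ K ⊗ D u
      Y = u ^⊗ suc K ⊗ D u

    logarithm : Series
    logarithm m = sum-over (upTo m) (λ k → sgn k * ((ℤ.+ 1 / suc k) * (u ^⊗ suc k) m))

    -- The power rule cancels the denominator of each summand. The cut-off moves with the
    -- coefficient, so no single partial sum is the derivative.
    D-logarithm : ∀ m → D logarithm m ≡ partial (suc m) m
    D-logarithm m = trans (sum-over-cong (upTo (suc m)) summand) (sum-term (suc m))
      where
      summand : ∀ k → sgn k * ((ℤ.+ 1 / suc k) * (u ^⊗ suc k) (suc m)) ≡ term k m
      summand k = cong (sgn k *_) (begin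
        r * (u ^⊗ suc k) (suc m)    ≡⟨ cong (r *_) (D-^ u k m) ⟩
        r * (fromℕ (suc k) * X)     ≡⟨ solve 3 (λ r n x → r :* (n :* x) := (n :* r) :* x) refl r (fromℕ (suc k)) X ⟩
        fromℕ (suc k) * r * X       ≡⟨ cong (_* X) (trans (fromℕ-*-/ 1 k) fromℕ-1) ⟩
        1ℚ * X                      ≡⟨ *-identityˡ X ⟩
        X ∎)
        where
        r = ℤ.+ 1 / suc k
        X = (u ^⊗ k ⊗ D u) m
      sum-term : ∀ K → sum-over (upTo K) (λ k → term k m) ≡ partial K m
      sum-term zero    = refl
      sum-term (suc K) = trans (sum-over-upTo-sucʳ (λ k → term k m) K) (cong (_+ term K m) (sum-term K))

    D-logarithm-⊗ : D logarithm ⊗ (oneS ⊕ u) ≗ D u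
    D-logarithm-⊗ m = begin
      (D logarithm ⊗ (oneS ⊕ u)) m
        -- The coefficients up to `m` come from different cut-offs; they are all raised to `suc m`,
        -- where telescoping applies and the remainder vanishes at index `m`.
        ≡⟨ ⊗-cong-≤ (D logarithm) (partial (suc m)) (oneS ⊕ u) m (λ j j≤m → trans (D-logarithm j) (stable j j≤m)) ⟩
      (partial (suc m) ⊗ (oneS ⊕ u)) m
        ≡⟨ partial-⊗ (suc m) m ⟩
      D u m + - 1ℚ * term (suc m) m
        ≡⟨ cong (λ x → D u m + - 1ℚ * x) (term-vanish (suc m) m (ℕ.n<1+n m)) ⟩
      D u m + - 1ℚ * 0ℚ
        ≡⟨ +-identityʳ (D u m) ⟩
      D u m ∎
      where
      stable : ∀ j → j ℕ.≤ m → partial (suc j) j ≡ partial (suc m) j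
      stable j j≤m = trans (sym (partial-stable j (m ℕ.∸ j)))
        (cong (λ K → partial K j) (trans (ℕ.+-suc (m ℕ.∸ j) j) (cong suc (ℕ.m∸n+n≡m j≤m))))

  egf-logM-⊗ : D (egf (λ m → - logM m)) ⊗ egf Mser ≗ (- 1ℚ) ⊙ D (egf Mser)
  egf-logM-⊗ m = begin
    (D (egf (λ m → - logM m)) ⊗ egf Mser) m
      ≡⟨ ⊗-cong (λ i → egf-logM (suc i)) egf-Mser m ⟩
    (((- 1ℚ) ⊙ D logarithm) ⊗ (oneS ⊕ u)) m
      ≡⟨ ⊗-⊙ˡ (- 1ℚ) (D logarithm) (oneS ⊕ u) m ⟩
    - 1ℚ * (D logarithm ⊗ (oneS ⊕ u)) m
      ≡⟨ cong (- 1ℚ *_) (D-logarithm-⊗ m) ⟩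
    - 1ℚ * D (egf Mser) m ∎
    where
    u = egf User
    open Logarithm u (*-zeroʳ (fromℕ 1))
    egf-Mser : egf Mser ≗ oneS ⊕ u
    egf-Mser zero    = trans (cong (_* 1ℚ) fromℕ-1)
      (sym (trans (cong (λ n → 1ℚ + n * 0ℚ) fromℕ-1) refl))
    egf-Mser (suc m) = sym (+-identityˡ (egf Mser (suc m)))
    -- The factorial passes into the finite sum and turns the Cauchy powers into powers under `_⊗_`.
    egf-logM : ∀ m → egf (λ m → - logM m) m ≡ - 1ℚ * logarithm m
    egf-logM m = begin
      n * - logM m
        ≡⟨ solve 2 (λ n x → n :* (:- x) := con (- 1ℚ) :* (n :* x)) refl n (logM m) ⟩
      - 1ℚ * (n * logM m)
        ≡⟨ cong (λ x → - 1ℚ * (n * x)) (sumℚ-map (λ k → sgn k * ((ℤ.+ 1 / suc k) * (User ^S suc k) m)) (upTo m)) ⟩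
      - 1ℚ * (n * sum-over (upTo m) (λ k → sgn k * ((ℤ.+ 1 / suc k) * (User ^S suc k) m)))
        ≡⟨ cong (- 1ℚ *_) (sum-over-*ˡ (upTo m) n (λ k → sgn k * ((ℤ.+ 1 / suc k) * (User ^S suc k) m))) ⟨
      - 1ℚ * sum-over (upTo m) (λ k → n * (sgn k * ((ℤ.+ 1 / suc k) * (User ^S suc k) m)))
        ≡⟨ cong (- 1ℚ *_) (sum-over-cong (upTo m) λ k → trans
             (solve 4 (λ n s r x → n :* (s :* (r :* x)) := s :* (r :* (n :* x))) refl
                n (sgn k) (ℤ.+ 1 / suc k) ((User ^S suc k) m))
             (cong (λ x → sgn k * ((ℤ.+ 1 / suc k) * x)) (egf-^ User (suc k) m))) ⟩
      - 1ℚ * logarithm m ∎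
      where n = fromℕ (m !)

-- Decidability, sources and sinks, and connectedness

module Matchings where

  open import Defs
  open FiniteSums using (Finite; enum; complete; finite-Fin)
  open import Data.Bool using (Bool; true)
  import Data.Bool.Properties as Bool
  open import Data.Empty using (⊥-elim)
  open import Data.Fin as Fin using (Fin; suc; toℕ; fromℕ; fromℕ<)
  open import Data.Fin.Induction using (spo-wellFounded)
  open import Data.Fin.Properties as Fin using (any?; all?)
  open import Data.List using (List; []; _∷_)
  open import Data.List.Membership.Propositional using (_∈_)
  open import Data.List.Relation.Unary.Any using (here; there)
  open import Data.Nat as ℕ using (ℕ; suc; z≤n)
  import Data.Nat.Properties as ℕ
  open import Data.Product using (∃; _×_; _,_; proj₁; proj₂)
  open import Data.Sum using (_⊎_; inj₁; inj₂)
  open import Data.Vec using (Vec; lookup)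
  open import Function using (flip)
  open import Induction.WellFounded using (Acc; acc)
  open import Relation.Binary using (IsStrictPartialOrder)
  open import Relation.Binary.Construct.Closure.Transitive as Closure using (TransClosure; [_]; _∷_; _∷ʳ_)
  open import Relation.Binary.PropositionalEquality
  open import Relation.Nullary using (Dec; yes; no; ¬_)
  open import Relation.Nullary.Decidable using (¬?; _×-dec_; _⊎-dec_; _→-dec_; map′)

  module _ {A : Set} {{_ : Finite A}} (R : A → A → Set) where

    -- Warshall's algorithm: paths all of whose inner vertices lie in the list.
    Via : List A → A → A → Set
    Via []       a b = R a b
    Via (v ∷ vs) a b = Via vs a b ⊎ (Via vs a v × Via vs v b)

    via⇒path : ∀ vs {a b} → Via vs a b → TransClosure R a b
    via⇒path []       r              = [ r ]
    via⇒path (v ∷ vs) (inj₁ p)       = via⇒path vs p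
    via⇒path (v ∷ vs) (inj₂ (p , q)) = via⇒path vs p Closure.++ via⇒path vs q

    edge⇒via : ∀ vs {a b} → R a b → Via vs a b
    edge⇒via []       r = r
    edge⇒via (v ∷ vs) r = inj₁ (edge⇒via vs r)

    -- If `j` is the head, the paths are cut where they first reach it and last leave it. If both
    -- paths pass through the head, the detour between these visits, which contains `j`, is dropped.
    via-trans : ∀ {vs j a b} → j ∈ vs → Via vs a j → Via vs j b → Via vs a b
    via-trans {v ∷ vs} (here refl) p q = inj₂ (to-v p , from-v q)
      where
      to-v : ∀ {a} → Via (v ∷ vs) a v → Via vs a v
      to-v (inj₁ p)       = p
      to-v (inj₂ (p , _)) = p
      from-v : ∀ {b} → Via (v ∷ vs) v b → Via vs v b
      from-v (inj₁ q)       = q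
      from-v (inj₂ (_ , q)) = q
    via-trans (there j∈) (inj₁ p)        (inj₁ q)        = inj₁ (via-trans j∈ p q)
    via-trans (there j∈) (inj₁ p)        (inj₂ (q , q′)) = inj₂ (via-trans j∈ p q , q′)
    via-trans (there j∈) (inj₂ (p , p′)) (inj₁ q)        = inj₂ (p , via-trans j∈ p′ q)
    via-trans (there j∈) (inj₂ (p , _))  (inj₂ (_ , q′)) = inj₂ (p , q′)

    path⇒via : ∀ {a b} → TransClosure R a b → Via enum a b
    path⇒via [ r ]   = edge⇒via enum r
    path⇒via (r ∷ p) = via-trans (complete _) (edge⇒via enum r) (path⇒via p)

    path? : (∀ a b → Dec (R a b)) → ∀ a b → Dec (TransClosure R a b)
    path? R? a b = map′ (via⇒path enum) path⇒via (via? enum a b)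
      where
      via? : ∀ vs a b → Dec (Via vs a b)
      via? []       = R?
      via? (v ∷ vs) a b = via? vs a b ⊎-dec (via? vs a v ×-dec via? vs v b)

  flip-path : ∀ {A : Set} {R : A → A → Set} {a b} → TransClosure (flip R) a b → TransClosure R b a
  flip-path [ r ]   = [ r ]
  flip-path (r ∷ p) = flip-path p ∷ʳ r

  module _ {N} (R : Fin N → Fin N → Set) (R? : ∀ a b → Dec (R a b))
           (acyclic : ∀ a → ¬ TransClosure R a a) where

    -- The transitive closure of an acyclic relation on a finite set is a strict partial order,
    -- hence well-founded, so walking backwards inside `P` must stop.
    source-in : (P : Fin N → Set) → (∀ {a b} → R a b → P b → P a) →
                ∀ x → P x → ∃ λ s → P s × (∀ b → ¬ R b s)
    source-in P closed x px = go x px (spo-wellFounded isSPO x)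
      where
      isSPO : IsStrictPartialOrder _≡_ (TransClosure R)
      isSPO = record
        { isEquivalence = isEquivalence
        ; irrefl        = λ { {a} refl p → acyclic a p }
        ; trans         = Closure._++_
        ; <-resp-≈      = (λ { refl p → p }) , (λ { refl p → p }) }
      go : ∀ x → P x → Acc (TransClosure R) x → ∃ λ s → P s × (∀ b → ¬ R b s)
      go x px (acc rs) with any? (λ b → R? b x)
      ... | yes (b , r) = go b (closed r px) (rs [ r ])
      ... | no  ∄b      = x , px , λ b r → ∄b (b , r)

  module _ {N} (R : Fin N → Fin N → Set) (R? : ∀ a b → Dec (R a b))
           (acyclic : ∀ a → ¬ TransClosure R a a) where

    sink-in : (P : Fin N → Set) → (∀ {a b} → R a b → P a → P b) →
              ∀ x → P x → ∃ λ s → P s × (∀ b → ¬ R s b)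
    sink-in P closed =
      source-in (flip R) (λ a b → R? b a) (λ a p → acyclic a (flip-path p)) P (λ r → closed r)

  Configuration : ℕ → Set
  Configuration N = Vec (Fin N) N × Vec (Vec Bool N) N

  -- `Good` for an arbitrary number of points, as the pieces of a colouring can have any size; at
  -- `2 * n` it unfolds to `Good n`.
  IsGood : ∀ {N} → Configuration N → Set
  IsGood (σ , r) = IsMatching σ × IsConnected σ × IsOrientation σ r × IsAcyclic σ r × UniqueSourceAtOne σ r

  IsNoncrossing : ∀ {N} → Vec (Fin N) N → Set
  IsNoncrossing σ = IsMatching σ × (∀ a b → ¬ Cross σ a b)

  module _ {N} (σ : Vec (Fin N) N) where

    matching? : Dec (IsMatching σ)
    matching? = all? λ i → ¬? (partner σ i Fin.≟ i) ×-dec (partner σ (partner σ i) Fin.≟ i)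

    connected? : Dec (IsConnected σ)
    connected? = all? λ a → all? λ b → (a Fin.≤? b) →-dec
      (¬? ((toℕ a ℕ.≟ 0) ×-dec (suc (toℕ b) ℕ.≟ N)) →-dec
      ¬? (all? λ i → (a Fin.≤? i) →-dec ((i Fin.≤? b) →-dec
            ((a Fin.≤? partner σ i) ×-dec (partner σ i Fin.≤? b)))))

    cross? : ∀ a b → Dec (Cross σ a b)
    cross? a b = (a Fin.<? b) ×-dec ((b Fin.<? partner σ a) ×-dec (partner σ a Fin.<? partner σ b))

    edge? : ∀ a b → Dec (Edge σ a b)
    edge? a b = cross? a b ⊎-dec cross? b a

    opaque
      noncrossing? : Dec (IsNoncrossing σ)
      noncrossing? = matching? ×-dec (all? λ a → all? λ b → ¬? (cross? a b))

    cross⇒archˡ : ∀ {a b} → Cross σ a b → IsArch σ a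
    cross⇒archˡ (a<b , b<pa , _) = ℕ.<-trans a<b b<pa

    cross⇒archʳ : ∀ {a b} → Cross σ a b → IsArch σ b
    cross⇒archʳ (_ , b<pa , pa<pb) = ℕ.<-trans b<pa pa<pb

    edge⇒archˡ : ∀ {a b} → Edge σ a b → IsArch σ a
    edge⇒archˡ (inj₁ x) = cross⇒archˡ x
    edge⇒archˡ (inj₂ x) = cross⇒archʳ x

    edge⇒archʳ : ∀ {a b} → Edge σ a b → IsArch σ b
    edge⇒archʳ (inj₁ x) = cross⇒archʳ x
    edge⇒archʳ (inj₂ x) = cross⇒archˡ x

    module _ (r : Vec (Vec Bool N) N) where

      arc? : ∀ a b → Dec (Arc σ r a b)
      arc? a b = lookup (lookup r a) b Bool.≟ true

      orientation? : Dec (IsOrientation σ r)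
      orientation? = (all? λ a → all? λ b → arc? a b →-dec edge? a b) ×-dec
        (all? λ a → all? λ b → edge? a b →-dec
          ((arc? a b ×-dec ¬? (arc? b a)) ⊎-dec (arc? b a ×-dec ¬? (arc? a b))))

      acyclic? : Dec (IsAcyclic σ r)
      acyclic? = all? λ a → ¬? (path? (Arc σ r) arc? a a)

      source? : ∀ v → Dec (IsSource σ r v)
      source? v = all? λ b → ¬? (arc? b v)

      uniqueSource? : Dec (UniqueSourceAtOne σ r)
      uniqueSource? = (all? λ v → (toℕ v ℕ.≟ 0) →-dec source? v) ×-dec
        (all? λ v → (v Fin.<? partner σ v) →-dec (source? v →-dec (toℕ v ℕ.≟ 0)))

  opaque
    good? : ∀ {N} (x : Configuration N) → Dec (IsGood x)
    good? (σ , r) = matching? σ ×-dec (connected? σ ×-dec (orientation? σ r ×-dec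
                    (acyclic? σ r ×-dec uniqueSource? σ r)))

  -- An interval of arches not containing 1 would contain another source, found by following
  -- arcs backwards: an arch crossing an arch of the interval lies in the interval.
  connected : ∀ {N} (σ : Vec (Fin N) N) (r : Vec (Vec Bool N) N) → IsMatching σ →
              IsOrientation σ r → IsAcyclic σ r → UniqueSourceAtOne σ r → IsConnected σ
  connected {N} σ r matching (arc⇒edge , _) acyclic (_ , unique-source) = go
    where
    inner-interval : ∀ x y → toℕ x ≢ 0 → x Fin.≤ y → ¬ UnionOfArches σ x y
    inner-interval x y x≢0 x≤y union =
      let (s , (x≤s , _ , arch) , source) = source-in (Arc σ r) (arc? σ r) acyclic Inside closed x inside-x
      in x≢0 (ℕ.n≤0⇒n≡0 (subst (toℕ x ℕ.≤_) (unique-source s arch source) x≤s))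
      where
      Inside : Fin N → Set
      Inside v = x Fin.≤ v × v Fin.≤ y × IsArch σ v
      inside-x : Inside x
      inside-x = Fin.≤-refl , x≤y ,
        ℕ.≤∧≢⇒< (proj₁ (union x Fin.≤-refl x≤y)) λ eq → proj₁ (matching x) (sym (Fin.toℕ-injective eq))
      closed : ∀ {u v} → Arc σ r u v → Inside v → Inside u
      closed {u} {v} a (x≤v , v≤y , arch) = inside (arc⇒edge u v a)
        where
        inside : Edge σ u v → Inside u
        -- `u` could start left of the interval, but its right end lies between `v` and the partner
        -- of `v`; being in the interval, that end brings `u` with it.
        inside e@(inj₁ (u<v , v<pu , pu<pv)) =
          let x≤pu = ℕ.≤-trans x≤v (ℕ.<⇒≤ v<pu)
              pu≤y = ℕ.≤-trans (ℕ.<⇒≤ pu<pv) (proj₂ (union v x≤v v≤y))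
              x≤ppu , ppu≤y = union (partner σ u) x≤pu pu≤y
          in subst (x Fin.≤_) (proj₂ (matching u)) x≤ppu ,
             subst (Fin._≤ y) (proj₂ (matching u)) ppu≤y , edge⇒archˡ σ e
        inside e@(inj₂ (v<u , u<pv , _)) =
          ℕ.≤-trans x≤v (ℕ.<⇒≤ v<u) ,
          ℕ.≤-trans (ℕ.<⇒≤ u<pv) (proj₂ (union v x≤v v≤y)) , edge⇒archˡ σ e

    go : IsConnected σ
    go a b a≤b proper union with toℕ a ℕ.≟ 0 | suc (toℕ b) ℕ.≟ N
    ... | no  a≢0 | _         = inner-interval a b a≢0 a≤b union
    ... | yes a≡0 | yes b-max = proper (a≡0 , b-max)
    -- A proper initial interval that is a union of arches has a complement of the same kind, from
    -- `b + 1` to the end, and this one avoids the point 1.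
    ... | yes a≡0 | no  b≢max = inner-interval x (last x) (λ x≡0 → ℕ.1+n≢0 (trans (sym x≡1+b) x≡0)) (≤-last x)
                                 λ i x≤i _ → complement i x≤i , ≤-last′ x (partner σ i)
      where
      1+b<N : suc (toℕ b) ℕ.< N
      1+b<N = ℕ.≤∧≢⇒< (Fin.toℕ<n b) b≢max
      x : Fin N
      x = fromℕ< 1+b<N
      x≡1+b : toℕ x ≡ suc (toℕ b)
      x≡1+b = Fin.toℕ-fromℕ< 1+b<N
      last : ∀ {n} → Fin n → Fin n
      last {suc n} _ = fromℕ n
      ≤-last′ : ∀ {n} (i j : Fin n) → j Fin.≤ last i
      ≤-last′ {suc n} _ j = Fin.≤fromℕ j
      ≤-last : ∀ {n} (i : Fin n) → i Fin.≤ last i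
      ≤-last i = ≤-last′ i i
      complement : ∀ i → x Fin.≤ i → x Fin.≤ partner σ i
      complement i x≤i with partner σ i Fin.≤? b
      ... | no  pi≰b = subst (ℕ._≤ toℕ (partner σ i)) (sym x≡1+b) (ℕ.≰⇒> pi≰b)
      ... | yes pi≤b = ⊥-elim (ℕ.<⇒≱ (subst (ℕ._≤ toℕ i) x≡1+b x≤i)
        (subst (Fin._≤ b) (proj₂ (matching i))
          (proj₂ (union (partner σ i) (subst (ℕ._≤ toℕ (partner σ i)) (sym a≡0) z≤n) pi≤b))))

-- Cutting a coloured configuration into its two pieces

module Split where

  open import Defs
  open FiniteSums
  open Matchings
  open ShuffleProduct using (count)
  open import Data.Bool using (Bool; true; false)
  import Data.Bool.Properties as Bool
  open import Data.Empty using (⊥-elim)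
  open import Data.Fin as Fin using (Fin; zero; suc; toℕ)
  open import Data.Fin.Properties as Fin using (all?)
  open import Data.Nat as ℕ using (ℕ; zero; suc; s≤s; z≤n)
  import Data.Nat.Properties as ℕ
  open import Data.Product using (_×_; _,_; proj₁; proj₂)
  open import Data.Rational using (ℚ; _*_)
  open import Data.Sum as Sum using (_⊎_; inj₁; inj₂)
  open import Data.Vec using (Vec; _∷_; lookup; tabulate)
  open import Data.Vec.Properties using (lookup∘tabulate; tabulate∘lookup; tabulate-cong)
  open import Function using (_∘_)
  open import Relation.Binary using (tri<; tri≈; tri>)
  open import Relation.Binary.Construct.Closure.Transitive using (TransClosure; [_]; _∷_)
  open import Relation.Binary.PropositionalEquality
  open import Relation.Nullary using (Dec; yes; no; ¬_; does)
  open import Relation.Nullary.Decidable using (¬?; _×-dec_; _→-dec_; dec-true)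

  -- The increasing enumeration of the positions of colour `k`. Arches and crossings depend only on
  -- order, so they transfer in both directions.
  emb : ∀ {n} (c : Vec Bool n) k → Fin (count k c) → Fin n
  emb (false ∷ c) false zero    = zero
  emb (false ∷ c) false (suc i) = suc (emb c false i)
  emb (false ∷ c) true  i       = suc (emb c true i)
  emb (true  ∷ c) false i       = suc (emb c false i)
  emb (true  ∷ c) true  zero    = zero
  emb (true  ∷ c) true  (suc i) = suc (emb c true i)

  lookup-emb : ∀ {n} (c : Vec Bool n) k i → lookup c (emb c k i) ≡ k
  lookup-emb (false ∷ c) false zero    = refl
  lookup-emb (false ∷ c) false (suc i) = lookup-emb c false i
  lookup-emb (false ∷ c) true  i       = lookup-emb c true i
  lookup-emb (true  ∷ c) false i       = lookup-emb c false i
  lookup-emb (true  ∷ c) true  zero    = refl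
  lookup-emb (true  ∷ c) true  (suc i) = lookup-emb c true i

  emb-mono-< : ∀ {n} (c : Vec Bool n) k {i j} → i Fin.< j → emb c k i Fin.< emb c k j
  emb-mono-< (false ∷ c) false {zero}  {suc j} _         = s≤s z≤n
  emb-mono-< (false ∷ c) false {suc i} {suc j} (s≤s i<j) = s≤s (emb-mono-< c false i<j)
  emb-mono-< (false ∷ c) true                  i<j       = s≤s (emb-mono-< c true i<j)
  emb-mono-< (true  ∷ c) false                 i<j       = s≤s (emb-mono-< c false i<j)
  emb-mono-< (true  ∷ c) true  {zero}  {suc j} _         = s≤s z≤n
  emb-mono-< (true  ∷ c) true  {suc i} {suc j} (s≤s i<j) = s≤s (emb-mono-< c true i<j)

  emb-cancel-< : ∀ {n} (c : Vec Bool n) k {i j} → emb c k i Fin.< emb c k j → i Fin.< j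
  emb-cancel-< c k {i} {j} ei<ej with Fin.<-cmp i j
  ... | tri< i<j _ _  = i<j
  ... | tri≈ _ refl _ = ⊥-elim (ℕ.<-irrefl refl ei<ej)
  ... | tri> _ _ j<i  = ⊥-elim (ℕ.<-asym ei<ej (emb-mono-< c k j<i))

  emb-injective : ∀ {n} (c : Vec Bool n) k {i j} → emb c k i ≡ emb c k j → i ≡ j
  emb-injective c k {i} {j} eq with Fin.<-cmp i j
  ... | tri< i<j _ _ = ⊥-elim (ℕ.<-irrefl (cong toℕ eq) (emb-mono-< c k i<j))
  ... | tri≈ _ i≡j _ = i≡j
  ... | tri> _ _ j<i = ⊥-elim (ℕ.<-irrefl (cong toℕ (sym eq)) (emb-mono-< c k j<i))

  toℕ≤toℕ-emb : ∀ {n} (c : Vec Bool n) k i → toℕ i ℕ.≤ toℕ (emb c k i)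
  toℕ≤toℕ-emb (false ∷ c) false zero    = z≤n
  toℕ≤toℕ-emb (false ∷ c) false (suc i) = s≤s (toℕ≤toℕ-emb c false i)
  toℕ≤toℕ-emb (false ∷ c) true  i       = ℕ.m≤n⇒m≤1+n (toℕ≤toℕ-emb c true i)
  toℕ≤toℕ-emb (true  ∷ c) false i       = ℕ.m≤n⇒m≤1+n (toℕ≤toℕ-emb c false i)
  toℕ≤toℕ-emb (true  ∷ c) true  zero    = z≤n
  toℕ≤toℕ-emb (true  ∷ c) true  (suc i) = s≤s (toℕ≤toℕ-emb c true i)

  toℕ-emb⁻-0 : ∀ {n} (c : Vec Bool n) k i → toℕ (emb c k i) ≡ 0 → toℕ i ≡ 0
  toℕ-emb⁻-0 c k i eq = ℕ.n≤0⇒n≡0 (subst (toℕ i ℕ.≤_) eq (toℕ≤toℕ-emb c k i))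

  toℕ-emb-0 : ∀ {n} (c : Vec Bool n) i → toℕ i ≡ 0 → toℕ (emb (false ∷ c) false i) ≡ 0
  toℕ-emb-0 c zero _ = refl

  -- A position seen as a colour together with a rank among the positions of that colour.
  data Emb {n} (c : Vec Bool n) : Fin n → Set where
    at : ∀ k i → Emb c (emb c k i)

  embView : ∀ {n} (c : Vec Bool n) j → Emb c j
  embView (false ∷ c) zero = at false zero
  embView (true  ∷ c) zero = at true zero
  embView (x ∷ c) (suc j) with embView c j
  embView (false ∷ c) (suc _) | at false i = at false (suc i)
  embView (false ∷ c) (suc _) | at true  i = at true i
  embView (true  ∷ c) (suc _) | at false i = at false i
  embView (true  ∷ c) (suc _) | at true  i = at true (suc i)

  embView-emb : ∀ {n} (c : Vec Bool n) k i → embView c (emb c k i) ≡ at k i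
  embView-emb (false ∷ c) false zero    = refl
  embView-emb (false ∷ c) false (suc i) rewrite embView-emb c false i = refl
  embView-emb (false ∷ c) true  i       rewrite embView-emb c true i = refl
  embView-emb (true  ∷ c) false i       rewrite embView-emb c false i = refl
  embView-emb (true  ∷ c) true  zero    = refl
  embView-emb (true  ∷ c) true  (suc i) rewrite embView-emb c true i = refl

  -- A left inverse of emb c k; the first argument of type Fin is the junk value
  -- taken at positions of the other colour.
  prj : ∀ {n} (c : Vec Bool n) k → Fin (count k c) → Fin n → Fin (count k c)
  prj c k i₀ j with embView c j
  prj c false i₀ _ | at false i = i
  prj c false i₀ _ | at true  _ = i₀
  prj c true  i₀ _ | at false _ = i₀
  prj c true  i₀ _ | at true  i = i

  emb-prj : ∀ {n} (c : Vec Bool n) k i₀ j → lookup c j ≡ k → emb c k (prj c k i₀ j) ≡ j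
  emb-prj c k i₀ j eq with embView c j
  emb-prj c false i₀ _ eq | at false i = refl
  emb-prj c false i₀ _ eq | at true  i with () ← trans (sym (lookup-emb c true i)) eq
  emb-prj c true  i₀ _ eq | at false i with () ← trans (sym (lookup-emb c false i)) eq
  emb-prj c true  i₀ _ eq | at true  i = refl

  lookup-ext : ∀ {A : Set} {n} {v w : Vec A n} → (∀ i → lookup v i ≡ lookup w i) → v ≡ w
  lookup-ext {v = v} {w} eq = trans (sym (tabulate∘lookup v)) (trans (tabulate-cong eq) (tabulate∘lookup w))

  matrix-ext : ∀ {A : Set} {m n} {v w : Vec (Vec A n) m} →
               (∀ i j → lookup (lookup v i) j ≡ lookup (lookup w i) j) → v ≡ w
  matrix-ext eq = lookup-ext λ i → lookup-ext (eq i)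

  lookup-matrix : ∀ {A : Set} {m n} (f : Fin m → Fin n → A) i j →
                  lookup (lookup (tabulate (λ i → tabulate (f i))) i) j ≡ f i j
  lookup-matrix f i j = trans (cong (λ v → lookup v j) (lookup∘tabulate (λ i → tabulate (f i)) i))
                              (lookup∘tabulate (f i) j)

  does-true⇒ : ∀ {P : Set} (d : Dec P) → does d ≡ true → P
  does-true⇒ (yes p) _ = p

  ≡-does : ∀ {P : Set} {b} (d : Dec P) → (P → b ≡ true) → (b ≡ true → P) → b ≡ does d
  ≡-does (yes p) to from = to p
  ≡-does (no ¬p) to from = Bool.¬-not (λ eq → ¬p (from eq))

  module _ {N} (c : Vec Bool N) where

    -- The arches coloured true are to be removed from an acyclically oriented crossing graph
    -- with source 1; being sinks, they are pairwise non-crossing, and removing them creates no new source.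
    IsColoured : Configuration N → Set
    IsColoured (σ , o) =
      IsMatching σ × IsOrientation σ o × IsAcyclic σ o × (∀ v → toℕ v ≡ 0 → IsSource σ o v) ×
      (∀ i → lookup c (partner σ i) ≡ lookup c i) ×
      (∀ i → lookup c i ≡ true → ∀ j → ¬ Arc σ o i j) ×
      (∀ v → toℕ v ≡ 0 → lookup c v ≡ false) ×
      (∀ v → IsArch σ v → IsSource σ o v → lookup c v ≡ false → toℕ v ≡ 0)

    opaque
      coloured? : ∀ x → Dec (IsColoured x)
      coloured? (σ , o) =
        matching? σ ×-dec orientation? σ o ×-dec acyclic? σ o ×-dec
        (all? λ v → (toℕ v ℕ.≟ 0) →-dec source? σ o v) ×-dec
        (all? λ i → lookup c (partner σ i) Bool.≟ lookup c i) ×-dec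
        (all? λ i → (lookup c i Bool.≟ true) →-dec all? λ j → ¬? (arc? σ o i j)) ×-dec
        (all? λ v → (toℕ v ℕ.≟ 0) →-dec (lookup c v Bool.≟ false)) ×-dec
        (all? λ v → (v Fin.<? partner σ v) →-dec (source? σ o v →-dec
          ((lookup c v Bool.≟ false) →-dec (toℕ v ℕ.≟ 0))))

    Pieces : Set
    Pieces = Configuration (count false c) × Vec (Fin (count true c)) (count true c)

    piece : Pieces → ∀ k → Vec (Fin (count k c)) (count k c)
    piece ((σ₁ , _) , _) false = σ₁
    piece (_ , σ₂)       true  = σ₂

    -- Cutting and gluing are both measured against this relation. Each side determines the other:
    -- between the colours, an arc from false to true is present exactly when the arches cross, and
    -- no arc leaves a position coloured true.
    record Splits (x : Configuration N) (y : Pieces) : Set where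
      σ = proj₁ x
      o = proj₂ x
      r = proj₂ (proj₁ y)
      field
        partner-emb : ∀ k i → partner σ (emb c k i) ≡ emb c k (partner (piece y k) i)
        arc-false   : ∀ i j → lookup (lookup o (emb c false i)) (emb c false j) ≡ lookup (lookup r i) j
        arc-across  : ∀ i j → lookup (lookup o (emb c false i)) (emb c true j)
                            ≡ does (edge? σ (emb c false i) (emb c true j))
        arc-true    : ∀ i j → lookup (lookup o (emb c true i)) j ≡ false

      no-arc-true : ∀ {i j} → ¬ Arc σ o (emb c true i) j
      no-arc-true {i} {j} a with () ← trans (sym a) (arc-true i j)

      arch⁺ : ∀ {k i} → IsArch (piece y k) i → IsArch σ (emb c k i)
      arch⁺ {k} {i} lt = subst (emb c k i Fin.<_) (sym (partner-emb k i)) (emb-mono-< c k lt)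

      arch⁻ : ∀ {k i} → IsArch σ (emb c k i) → IsArch (piece y k) i
      arch⁻ {k} {i} lt = emb-cancel-< c k (subst (emb c k i Fin.<_) (partner-emb k i) lt)

      cross⁺ : ∀ {k i j} → Cross (piece y k) i j → Cross σ (emb c k i) (emb c k j)
      cross⁺ {k} {i} {j} (p , q , s) rewrite partner-emb k i | partner-emb k j =
        emb-mono-< c k p , emb-mono-< c k q , emb-mono-< c k s

      cross⁻ : ∀ {k i j} → Cross σ (emb c k i) (emb c k j) → Cross (piece y k) i j
      cross⁻ {k} {i} {j} (p , q , s) rewrite partner-emb k i | partner-emb k j =
        emb-cancel-< c k p , emb-cancel-< c k q , emb-cancel-< c k s

      edge⁺ : ∀ {k i j} → Edge (piece y k) i j → Edge σ (emb c k i) (emb c k j)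
      edge⁺ {k} = Sum.map (cross⁺ {k}) (cross⁺ {k})

      edge⁻ : ∀ {k i j} → Edge σ (emb c k i) (emb c k j) → Edge (piece y k) i j
      edge⁻ {k} = Sum.map (cross⁻ {k}) (cross⁻ {k})

      arc⁺ : ∀ {i j} → Arc (piece y false) r i j → Arc σ o (emb c false i) (emb c false j)
      arc⁺ {i} {j} = trans (arc-false i j)

      arc⁻ : ∀ {i j} → Arc σ o (emb c false i) (emb c false j) → Arc (piece y false) r i j
      arc⁻ {i} {j} = trans (sym (arc-false i j))

      matching⁻ : IsMatching σ → ∀ k → IsMatching (piece y k)
      matching⁻ matching k i =
        (λ eq → proj₁ (matching (emb c k i)) (trans (partner-emb k i) (cong (emb c k) eq))) ,
        emb-injective c k (begin
          emb c k (partner (piece y k) (partner (piece y k) i))  ≡⟨ partner-emb k (partner (piece y k) i) ⟨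
          partner σ (emb c k (partner (piece y k) i))            ≡⟨ cong (partner σ) (partner-emb k i) ⟨
          partner σ (partner σ (emb c k i))                      ≡⟨ proj₂ (matching (emb c k i)) ⟩
          emb c k i ∎)
        where open ≡-Reasoning

      matching⁺ : (∀ k → IsMatching (piece y k)) → IsMatching σ
      matching⁺ matching j with embView c j
      ... | at k i =
        (λ eq → proj₁ (matching k i) (emb-injective c k (trans (sym (partner-emb k i)) eq))) ,
        (begin
          partner σ (partner σ (emb c k i))                      ≡⟨ cong (partner σ) (partner-emb k i) ⟩
          partner σ (emb c k (partner (piece y k) i))            ≡⟨ partner-emb k (partner (piece y k) i) ⟩
          emb c k (partner (piece y k) (partner (piece y k) i))  ≡⟨ cong (emb c k) (proj₂ (matching k i)) ⟩
          emb c k i ∎)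
        where open ≡-Reasoning

      path⁺ : ∀ {i j} → TransClosure (Arc (piece y false) r) i j →
              TransClosure (Arc σ o) (emb c false i) (emb c false j)
      path⁺ [ a ]   = [ arc⁺ a ]
      path⁺ (a ∷ p) = arc⁺ a ∷ path⁺ p

      no-path-true : ∀ {i j} → ¬ TransClosure (Arc σ o) (emb c true i) j
      no-path-true [ a ]   = no-arc-true a
      no-path-true (a ∷ _) = no-arc-true a

      -- A position coloured true is a dead end, so a path between positions coloured false never
      -- visits one. The equations keep the endpoints variable for the recursion.
      path⁻ : ∀ {a b i j} → TransClosure (Arc σ o) a b → a ≡ emb c false i → b ≡ emb c false j →
              TransClosure (Arc (piece y false) r) i j
      path⁻ [ a ] refl refl = [ arc⁻ a ]
      path⁻ (_∷_ {y = z} a p) refl eq with embView c z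
      ... | at false _ = arc⁻ a ∷ path⁻ p refl eq
      ... | at true  _ = ⊥-elim (no-path-true p)

  module _ {m} (c′ : Vec Bool m) where

    private c = false ∷ c′

    -- A source of the false piece is a source of the whole, since no arc leaves the other colour.
    -- Two crossing arches coloured true would need an arc out of one of them.
    coloured⇒pieces : ∀ {x y} → Splits c x y → IsColoured c x → IsGood (proj₁ y) × IsNoncrossing (proj₂ y)
    coloured⇒pieces {σ , o} {(σ₁ , r) , σ₂} splits
      (matching , (arc⇒edge , edge⇒arc) , acyclic , source₀ , _ , sinks , _ , sources) =
      (matching₁ , connected σ₁ r matching₁ orientation₁ acyclic₁ unique₁ , orientation₁ , acyclic₁ , unique₁) ,
      (matching⁻ matching true , noncrossing)
      where
      open Splits splits hiding (σ; o; r)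
      matching₁ = matching⁻ matching false
      orientation₁ : IsOrientation σ₁ r
      orientation₁ =
        (λ i j a → edge⁻ {false} (arc⇒edge (emb c false i) (emb c false j) (arc⁺ a))) ,
        (λ i j e → Sum.map (λ (a , ¬a) → arc⁻ a , ¬a ∘ arc⁺) (λ (a , ¬a) → arc⁻ a , ¬a ∘ arc⁺)
                     (edge⇒arc (emb c false i) (emb c false j) (edge⁺ {false} e)))
      acyclic₁ : IsAcyclic σ₁ r
      acyclic₁ i p = acyclic (emb c false i) (path⁺ p)
      source⁺ : ∀ {i} → IsSource σ₁ r i → IsSource σ o (emb c false i)
      source⁺ source b a with embView c b
      ... | at false j = source j (arc⁻ a)
      ... | at true  j = no-arc-true a
      unique₁ : UniqueSourceAtOne σ₁ r
      unique₁ =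
        (λ i i≡0 j a → source₀ (emb c false i) (toℕ-emb-0 c′ i i≡0) (emb c false j) (arc⁺ a)) ,
        (λ i arch source → toℕ-emb⁻-0 c false i
          (sources (emb c false i) (arch⁺ {false} arch) (source⁺ source) (lookup-emb c false i)))
      noncrossing : ∀ i j → ¬ Cross σ₂ i j
      noncrossing i j x with edge⇒arc (emb c true i) (emb c true j) (inj₁ (cross⁺ {true} x))
      ... | inj₁ (a , _) = no-arc-true a
      ... | inj₂ (a , _) = no-arc-true a

    -- A cycle, or an arc into the arch of 1, could only lie in the false piece. A source coloured
    -- false is a source of its piece, hence the arch of the first point there, which is 1 because
    -- `c` starts with false.
    pieces⇒coloured : ∀ {x y} → Splits c x y → IsGood (proj₁ y) × IsNoncrossing (proj₂ y) → IsColoured c x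
    pieces⇒coloured {σ , o} {(σ₁ , r) , σ₂} splits
      ((matching₁ , _ , (arc⇒edge , edge⇒arc) , acyclic₁ , source₀ , sources) , (matching₂ , noncrossing)) =
      matching⁺ (λ { false → matching₁ ; true → matching₂ }) ,
      (arc⇒edge′ , edge⇒arc′) , acyclic , source₀′ , colour-invariant , sinks , first , sources′
      where
      open Splits splits hiding (σ; o; r)
      first : ∀ v → toℕ v ≡ 0 → lookup c v ≡ false
      first zero _ = refl
      arc⇒edge′ : ∀ a b → Arc σ o a b → Edge σ a b
      arc⇒edge′ a b arc with embView c a | embView c b
      ... | at false i | at false j = edge⁺ {false} (arc⇒edge i j (arc⁻ arc))
      ... | at false i | at true  j = does-true⇒ (edge? σ _ _) (trans (sym (arc-across i j)) arc)
      ... | at true  i | _          = ⊥-elim (no-arc-true arc)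
      edge⇒arc′ : ∀ a b → Edge σ a b → (Arc σ o a b × ¬ Arc σ o b a) ⊎ (Arc σ o b a × ¬ Arc σ o a b)
      edge⇒arc′ a b e with embView c a | embView c b
      ... | at false i | at false j =
        Sum.map (λ (a , ¬a) → arc⁺ a , ¬a ∘ arc⁻) (λ (a , ¬a) → arc⁺ a , ¬a ∘ arc⁻) (edge⇒arc i j (edge⁻ {false} e))
      ... | at false i | at true  j = inj₁ (trans (arc-across i j) (dec-true (edge? σ _ _) e) , no-arc-true)
      ... | at true  i | at false j =
        inj₂ (trans (arc-across j i) (dec-true (edge? σ _ _) (Sum.swap e)) , no-arc-true)
      ... | at true  i | at true  j with edge⁻ {true} e
      ...   | inj₁ x = ⊥-elim (noncrossing i j x)
      ...   | inj₂ x = ⊥-elim (noncrossing j i x)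
      acyclic : IsAcyclic σ o
      acyclic a p with embView c a
      ... | at false i = acyclic₁ i (path⁻ p refl refl)
      ... | at true  i = no-path-true p
      source₀′ : ∀ v → toℕ v ≡ 0 → IsSource σ o v
      source₀′ v v≡0 b arc with embView c b | embView c v
      ... | at true  j | _          = no-arc-true arc
      ... | at false j | at false i = source₀ i (toℕ-emb⁻-0 c false i v≡0) j (arc⁻ arc)
      ... | at false j | at true  i with () ← trans (sym (lookup-emb c true i)) (first (emb c true i) v≡0)
      colour-invariant : ∀ j → lookup c (partner σ j) ≡ lookup c j
      colour-invariant j with embView c j
      ... | at k i = trans (cong (lookup c) (partner-emb k i))
                           (trans (lookup-emb c k (partner (piece c ((σ₁ , r) , σ₂) k) i)) (sym (lookup-emb c k i)))
      sinks : ∀ i → lookup c i ≡ true → ∀ j → ¬ Arc σ o i j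
      sinks i eq j arc with embView c i
      ... | at true  _ = no-arc-true arc
      ... | at false i′ with () ← trans (sym (lookup-emb c false i′)) eq
      sources′ : ∀ v → IsArch σ v → IsSource σ o v → lookup c v ≡ false → toℕ v ≡ 0
      sources′ v arch source eq with embView c v
      ... | at false i = toℕ-emb-0 c′ i
        (sources i (arch⁻ {false} arch) (λ j a → source (emb c false j) (arc⁺ a)))
      ... | at true  i with () ← trans (sym (lookup-emb c true i)) eq

  module _ {N} (c : Vec Bool N) where

    restrict : Configuration N → Pieces c
    restrict (σ , o) = (restrict-σ false , tabulate λ i → tabulate λ j →
                          lookup (lookup o (emb c false i)) (emb c false j)) , restrict-σ true
      where
      restrict-σ : ∀ k → Vec (Fin (count k c)) (count k c)
      -- The default `i` is reached only if the partner has the other colour, which a colouring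
      -- constant on arches excludes.
      restrict-σ k = tabulate λ i → prj c k i (partner σ (emb c k i))

    module Glue (y : Pieces c) where

      entry-σ : ∀ {j} → Emb c j → Fin N
      entry-σ (at k i) = emb c k (partner (piece c y k) i)

      glue-σ : Vec (Fin N) N
      glue-σ = tabulate λ j → entry-σ (embView c j)

      entry-o : ∀ {a b} → Emb c a → Emb c b → Bool
      entry-o (at false i) (at false j) = lookup (lookup (proj₂ (proj₁ y)) i) j
      entry-o (at false i) (at true  j) = does (edge? glue-σ (emb c false i) (emb c true j))
      entry-o (at true  _) _            = false

      glue-o : Vec (Vec Bool N) N
      glue-o = tabulate λ a → tabulate λ b → entry-o (embView c a) (embView c b)

      lookup-glue-o : ∀ a b → lookup (lookup glue-o a) b ≡ entry-o (embView c a) (embView c b)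
      lookup-glue-o = lookup-matrix (λ a b → entry-o (embView c a) (embView c b))

    glue : Pieces c → Configuration N
    glue y = Glue.glue-σ y , Glue.glue-o y

    splits-glue : ∀ y → Splits c (glue y) y
    splits-glue y = record
      { partner-emb = λ k i → trans (lookup∘tabulate (λ j → entry-σ (embView c j)) (emb c k i))
                                    (cong entry-σ (embView-emb c k i))
      ; arc-false   = λ i j → trans (lookup-glue-o (emb c false i) (emb c false j))
                                    (cong₂ entry-o (embView-emb c false i) (embView-emb c false j))
      ; arc-across  = λ i j → trans (lookup-glue-o (emb c false i) (emb c true j))
                                    (cong₂ entry-o (embView-emb c false i) (embView-emb c true j))
      ; arc-true    = λ i j → trans (lookup-glue-o (emb c true i) j)
                                    (cong (λ e → entry-o e (embView c j)) (embView-emb c true i)) }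
      where open Glue y

    -- The orientation between the two colours carries no information: an edge pointing the other
    -- way would leave a sink.
    splits-restrict : ∀ x → IsColoured c x → Splits c x (restrict x)
    splits-restrict x@(σ , o) (_ , (arc⇒edge , edge⇒arc) , _ , _ , colour-invariant , sinks , _) = record
      { partner-emb = partner-emb
      ; arc-false   = λ i j → sym (lookup-matrix _ i j)
      ; arc-across  = arc-across
      ; arc-true    = λ i j → Bool.¬-not (sinks (emb c true i) (lookup-emb c true i) j) }
      where
      restricted : ∀ k i → emb c k (prj c k i (partner σ (emb c k i))) ≡ partner σ (emb c k i)
      restricted k i = emb-prj c k i (partner σ (emb c k i)) (trans (colour-invariant (emb c k i)) (lookup-emb c k i))
      partner-emb : ∀ k i → partner σ (emb c k i) ≡ emb c k (partner (piece c (restrict x) k) i)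
      partner-emb false i = sym (trans (cong (emb c false) (lookup∘tabulate _ i)) (restricted false i))
      partner-emb true  i = sym (trans (cong (emb c true) (lookup∘tabulate _ i)) (restricted true i))
      arc-across : ∀ i j → lookup (lookup o (emb c false i)) (emb c true j) ≡ does (edge? σ (emb c false i) (emb c true j))
      arc-across i j = ≡-does (edge? σ (emb c false i) (emb c true j))
        (λ e → outgoing (edge⇒arc (emb c false i) (emb c true j) e))
        (arc⇒edge (emb c false i) (emb c true j))
        where
        outgoing : ∀ {A B : Set} → (Arc σ o (emb c false i) (emb c true j) × A) ⊎ (Arc σ o (emb c true j) (emb c false i) × B) →
                   Arc σ o (emb c false i) (emb c true j)
        outgoing (inj₁ (a , _)) = a
        outgoing (inj₂ (a , _)) = ⊥-elim (sinks (emb c true j) (lookup-emb c true j) (emb c false i) a)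

    splits-injective : ∀ {x x′ y} → Splits c x y → Splits c x′ y → x ≡ x′
    -- The matchings are identified before the arcs, because the arcs between the colours are read
    -- off the crossings of the matching.
    splits-injective {σ , o} {σ′ , o′} {y} s s′ with lookup-ext {v = σ} {σ′} same-partner
      where
      same-partner : ∀ j → lookup σ j ≡ lookup σ′ j
      same-partner j with embView c j
      ... | at k i = trans (Splits.partner-emb s k i) (sym (Splits.partner-emb s′ k i))
    ... | refl = cong (σ ,_) (matrix-ext same-arcs)
      where
      same-arcs : ∀ a b → lookup (lookup o a) b ≡ lookup (lookup o′ a) b
      same-arcs a b with embView c a | embView c b
      ... | at false i | at false j = trans (Splits.arc-false s i j) (sym (Splits.arc-false s′ i j))
      ... | at false i | at true  j = trans (Splits.arc-across s i j) (sym (Splits.arc-across s′ i j))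
      ... | at true  i | _          = trans (Splits.arc-true s i b) (sym (Splits.arc-true s′ i b))

    splits-functional : ∀ {x y y′} → Splits c x y → Splits c x y′ → y ≡ y′
    splits-functional {σ , o} {y} {y′} s s′ = cong₂ _,_
      (cong₂ _,_ (lookup-ext (same-partner false))
        (matrix-ext λ i j → trans (sym (Splits.arc-false s i j)) (Splits.arc-false s′ i j)))
      (lookup-ext (same-partner true))
      where
      same-partner : ∀ k i → lookup (piece c y k) i ≡ lookup (piece c y′ k) i
      same-partner k i = emb-injective c k
        (trans (sym (Splits.partner-emb s k i)) (Splits.partner-emb s′ k i))

  goodCount : ℕ → ℚ
  goodCount N = ∑ {Configuration N} (λ x → ⟦ good? x ⟧)

  noncrossingCount : ℕ → ℚ
  noncrossingCount N = ∑ {Vec (Fin N) N} (λ σ → ⟦ noncrossing? σ ⟧)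

  -- `Splits` is injective and functional, so that `restrict` and `glue` are mutually inverse
  -- follows without computing either composite.
  ∑-coloured : ∀ {m} (c′ : Vec Bool m) → let c = false ∷ c′ in
    ∑ {Configuration (suc m)} (λ x → ⟦ coloured? c x ⟧) ≡ goodCount (count false c) * noncrossingCount (count true c)
  ∑-coloured {m} c′ = begin
    ∑ {Configuration (suc m)} (λ x → ⟦ coloured? c x ⟧)
      ≡⟨ ∑-bijection (coloured? c) pieces? (restrict c) (glue c) to from ⟩
    ∑ {Pieces c} (λ y → ⟦ pieces? y ⟧)
      ≡⟨ ∑-cong {A = Pieces c} (λ y → ⟦⟧-× (good? (proj₁ y)) (noncrossing? (proj₂ y))) ⟩
    ∑ {Pieces c} (λ y → ⟦ good? (proj₁ y) ⟧ * ⟦ noncrossing? (proj₂ y) ⟧)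
      ≡⟨ ∑-× {A = Configuration (count false c)} (λ y → ⟦ good? y ⟧) (λ σ₂ → ⟦ noncrossing? σ₂ ⟧) ⟩
    goodCount (count false c) * noncrossingCount (count true c) ∎
    where
    open ≡-Reasoning
    c = false ∷ c′
    pieces? : (y : Pieces c) → Dec (IsGood (proj₁ y) × IsNoncrossing (proj₂ y))
    pieces? y = good? (proj₁ y) ×-dec noncrossing? (proj₂ y)
    to : ∀ x → IsColoured c x →
         (IsGood (proj₁ (restrict c x)) × IsNoncrossing (proj₂ (restrict c x))) × glue c (restrict c x) ≡ x
    to x coloured = let s = splits-restrict c x coloured in
      coloured⇒pieces c′ s coloured , splits-injective c (splits-glue c (restrict c x)) s
    from : ∀ y → IsGood (proj₁ y) × IsNoncrossing (proj₂ y) →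
           IsColoured c (glue c y) × restrict c (glue c y) ≡ y
    from y pieces = let s = splits-glue c y ; coloured = pieces⇒coloured c′ s pieces in
      coloured , splits-functional c (splits-restrict c (glue c y) coloured) s

-- The sign-reversing recolouring of a sink

module Peel where

  open import Defs
  open FiniteSums
  open Matchings
  open Split
  open ShuffleProduct using (count)
  open import Data.Bool using (Bool; true; false; not)
  import Data.Bool.Properties as Bool
  open import Data.Empty using (⊥-elim)
  open import Data.Fin as Fin using (Fin; zero; suc; toℕ)
  open import Data.Fin.Properties as Fin using (all?; any?)
  open import Data.Nat as ℕ using (ℕ; zero; suc)
  import Data.Nat.Properties as ℕ
  open import Data.Product using (∃; _×_; _,_; proj₁; proj₂)
  open import Data.Rational using (ℚ; 0ℚ; 1ℚ; _*_; -_)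
  open import Data.Rational.Properties using (*-zeroˡ; *-zeroʳ; *-identityʳ)
  open import Data.Rational.Solver using (module +-*-Solver)
  open import Data.Sum using (inj₁; inj₂)
  open import Data.Vec using (Vec; _∷_; lookup; updateAt; replicate)
  open import Data.Vec.Properties
    using (lookup∘updateAt; lookup∘updateAt′; updateAt-commutes; updateAt-updateAt-local; updateAt-id; lookup-replicate)
  open import Function using (_∘_; case_of_)
  open import Relation.Binary.Construct.Closure.Transitive using ([_]; _∷_)
  open import Relation.Binary.PropositionalEquality
  open import Relation.Nullary using (Dec; yes; no; ¬_)
  open import Relation.Nullary.Decidable using (¬?; _×-dec_; _→-dec_)

  -- The real part of i ^ n.
  ε : ℕ → ℚ
  ε 0             = 1ℚ
  ε 1             = 0ℚ
  ε (suc (suc n)) = - ε n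

  count-flip-false : ∀ {n} (c : Vec Bool n) i → lookup c i ≡ false → count true (updateAt c i not) ≡ suc (count true c)
  count-flip-false (false ∷ c) zero    _  = refl
  count-flip-false (false ∷ c) (suc i) eq = count-flip-false c i eq
  count-flip-false (true  ∷ c) (suc i) eq = cong suc (count-flip-false c i eq)

  count-flip-true : ∀ {n} (c : Vec Bool n) i → lookup c i ≡ true → suc (count true (updateAt c i not)) ≡ count true c
  count-flip-true (true  ∷ c) zero    _  = refl
  count-flip-true (false ∷ c) (suc i) eq = count-flip-true c i eq
  count-flip-true (true  ∷ c) (suc i) eq = cong suc (count-flip-true c i eq)

  module Toggle {n} (s t : Fin n) (s≢t : s ≢ t) where

    toggle : Vec Bool n → Vec Bool n
    toggle c = updateAt (updateAt c s not) t not

    flip² : ∀ (c : Vec Bool n) i → updateAt (updateAt c i not) i not ≡ c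
    flip² c i = trans (updateAt-updateAt-local i c (Bool.not-involutive (lookup c i))) (updateAt-id i c)

    toggle² : ∀ c → toggle (toggle c) ≡ c
    toggle² c = begin
      updateAt (updateAt (updateAt (updateAt c s not) t not) s not) t not
        ≡⟨ cong (λ v → updateAt v t not) (updateAt-commutes s t s≢t (updateAt c s not)) ⟩
      updateAt (updateAt (updateAt (updateAt c s not) s not) t not) t not
        ≡⟨ flip² (updateAt (updateAt c s not) s not) t ⟩
      updateAt (updateAt c s not) s not
        ≡⟨ flip² c s ⟩
      c ∎
      where open ≡-Reasoning

    toggle-first : ∀ c → lookup (toggle c) s ≡ not (lookup c s)
    toggle-first c = trans (lookup∘updateAt′ s t s≢t (updateAt c s not)) (lookup∘updateAt s c)

    toggle-second : ∀ c → lookup (toggle c) t ≡ not (lookup c t)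
    toggle-second c = trans (lookup∘updateAt t (updateAt c s not))
                            (cong not (lookup∘updateAt′ t s (s≢t ∘ sym) c))

    toggle-other : ∀ c {i} → i ≢ s → i ≢ t → lookup (toggle c) i ≡ lookup c i
    toggle-other c {i} i≢s i≢t = trans (lookup∘updateAt′ i t i≢t (updateAt c s not)) (lookup∘updateAt′ i s i≢s c)

    -- Two equal colours change together, so the number of points coloured true moves by two.
    ε-toggle : ∀ c → lookup c s ≡ lookup c t → ε (count true (toggle c)) ≡ - ε (count true c)
    ε-toggle c eq with lookup c s in cs
    ... | false = cong ε (trans
      (count-flip-false (updateAt c s not) t (trans (lookup∘updateAt′ t s (s≢t ∘ sym) c) (sym eq)))
      (cong suc (count-flip-false c s cs)))
    -- Here the count drops by two; the recursion of `ε` then expresses the old value by the new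
    -- one, and a double negation turns it around.
    ... | true  = trans (solve 1 (λ x → x := :- (:- x)) refl (ε (count true (toggle c)))) (cong (-_ ∘ ε)
      (trans (cong suc (count-flip-true (updateAt c s not) t (trans (lookup∘updateAt′ t s (s≢t ∘ sym) c) (sym eq))))
             (count-flip-true c s cs)))
      where open +-*-Solver using (solve; _:=_; :-_)

  count-replicate : ∀ n → count true (replicate n true) ≡ n
  count-replicate zero    = refl
  count-replicate (suc n) = cong suc (count-replicate n)

  IsArcless : ∀ {N} → Configuration N → Set
  IsArcless (σ , o) = IsNoncrossing σ × (∀ a b → ¬ Arc σ o a b)

  opaque
    arcless? : ∀ {N} (x : Configuration N) → Dec (IsArcless x)
    arcless? (σ , o) = noncrossing? σ ×-dec (all? λ a → all? λ b → ¬? (arc? σ o a b))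

  colourSum : ∀ {N} → Configuration N → ℚ
  colourSum {N} x = ∑ {A = Vec Bool N} λ c → ⟦ coloured? c x ⟧ * ε (count true c)

  module _ {m} (σ : Vec (Fin (suc m)) (suc m)) (o : Vec (Vec Bool (suc m)) (suc m))
           (matching : IsMatching σ) (orientation : IsOrientation σ o) (acyclic : IsAcyclic σ o)
           (source₀ : ∀ v → toℕ v ≡ 0 → IsSource σ o v) where

    private
      partner≢ : ∀ i → i ≢ partner σ i
      partner≢ i eq = proj₁ (matching i) (sym eq)

      partner-flip : ∀ {i j} → partner σ i ≡ j → i ≡ partner σ j
      partner-flip {i} refl = sym (proj₂ (matching i))

      not-arch : ∀ {i} → IsArch σ i → ¬ IsArch σ (partner σ i)
      not-arch {i} lt lt′ = ℕ.<-asym lt (subst (partner σ i Fin.<_) (proj₂ (matching i)) lt′)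

    -- Recolouring the arch of a sink which is not a source is a sign-reversing involution.
    colourSum-arc : ∀ {a b} → Arc σ o a b → colourSum (σ , o) ≡ 0ℚ
    colourSum-arc {a} {b} arc = ∑-involution toggle (λ c → ⟦ coloured? c (σ , o) ⟧ * ε (count true c)) toggle² odd
      where
      sink : ∃ λ s → (∃ λ u → Arc σ o u s) × (∀ j → ¬ Arc σ o s j)
      -- The property carried forward from `b` is having an incoming arc, which the head of every
      -- arc has; so the sink found is not a source. It depends on the configuration only, not on
      -- the colouring.
      sink = sink-in (Arc σ o) (arc? σ o) acyclic (λ v → ∃ λ u → Arc σ o u v) (λ r _ → _ , r) b (a , arc)
      s = proj₁ sink
      u = proj₁ (proj₁ (proj₂ sink))
      u⟶s = proj₂ (proj₁ (proj₂ sink))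
      s-sink = proj₂ (proj₂ sink)
      t = partner σ s
      open Toggle s t (partner≢ s)

      s-arch : IsArch σ s
      s-arch = edge⇒archʳ σ (proj₁ orientation u s u⟶s)
      s≢0 : toℕ s ≢ 0
      s≢0 s≡0 = source₀ s s≡0 u u⟶s
      t≢0 : toℕ t ≢ 0
      t≢0 t≡0 = ℕ.n≮0 (subst (toℕ s ℕ.<_) t≡0 s-arch)
      -- Arcs join left endpoints, and `t` is a right endpoint, so colouring it true respects the
      -- sink condition.
      t-isolated : ∀ j → ¬ Arc σ o t j
      t-isolated j r = not-arch s-arch (edge⇒archˡ σ (proj₁ orientation t j r))

      toggle-coloured : ∀ c → IsColoured c (σ , o) → IsColoured (toggle c) (σ , o)
      toggle-coloured c (_ , _ , _ , _ , colour-invariant , sinks , first , sources) =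
        matching , orientation , acyclic , source₀ , colour-invariant′ , sinks′ , first′ , sources′
        where
        colour-invariant′ : ∀ i → lookup (toggle c) (partner σ i) ≡ lookup (toggle c) i
        colour-invariant′ i with i Fin.≟ s | i Fin.≟ t
        ... | yes refl | _        = trans (toggle-second c) (trans (cong not (colour-invariant s)) (sym (toggle-first c)))
        ... | no _     | yes refl = trans (cong (lookup (toggle c)) (proj₂ (matching s)))
          (trans (toggle-first c) (trans (cong not (sym (colour-invariant s))) (sym (toggle-second c))))
        ... | no i≢s   | no i≢t   = trans
          (toggle-other c (i≢t ∘ partner-flip) (λ eq → i≢s (trans (partner-flip eq) (proj₂ (matching s)))))
          (trans (colour-invariant i) (sym (toggle-other c i≢s i≢t)))
        sinks′ : ∀ i → lookup (toggle c) i ≡ true → ∀ j → ¬ Arc σ o i j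
        sinks′ i eq with i Fin.≟ s | i Fin.≟ t
        ... | yes refl | _        = s-sink
        ... | no _     | yes refl = t-isolated
        ... | no i≢s   | no i≢t   = sinks i (trans (sym (toggle-other c i≢s i≢t)) eq)
        first′ : ∀ v → toℕ v ≡ 0 → lookup (toggle c) v ≡ false
        first′ v v≡0 = trans (toggle-other c (λ { refl → s≢0 v≡0 }) (λ { refl → t≢0 v≡0 })) (first v v≡0)
        -- Neither recoloured position is concerned: `s` has an incoming arc and `t` is not a left
        -- endpoint.
        sources′ : ∀ v → IsArch σ v → IsSource σ o v → lookup (toggle c) v ≡ false → toℕ v ≡ 0
        sources′ v arch source eq with v Fin.≟ s | v Fin.≟ t
        ... | yes refl | _        = ⊥-elim (source u u⟶s)
        ... | no _     | yes refl = ⊥-elim (not-arch s-arch arch)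
        ... | no v≢s   | no v≢t   = sources v arch source (trans (sym (toggle-other c v≢s v≢t)) eq)

      Odd : Vec Bool (suc m) → Set
      Odd c = ⟦ coloured? (toggle c) (σ , o) ⟧ * ε (count true (toggle c)) ≡ - (⟦ coloured? c (σ , o) ⟧ * ε (count true c))
      odd : ∀ c → Odd c
      odd c = case coloured? c (σ , o) of λ
        { (yes coloured) → odd-coloured c coloured ; (no ¬coloured) → odd-uncoloured c ¬coloured }
        where
        open ≡-Reasoning
        open +-*-Solver using (solve; _:=_; :-_; con; _:*_)
        odd-coloured : ∀ c → IsColoured c (σ , o) → Odd c
        odd-coloured c coloured@(_ , _ , _ , _ , colour-invariant , _) = begin
          ⟦ coloured? (toggle c) (σ , o) ⟧ * ε (count true (toggle c))
            ≡⟨ cong₂ _*_ (⟦⟧-yes (coloured? (toggle c) (σ , o)) (toggle-coloured c coloured))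
                 (ε-toggle c (sym (colour-invariant s))) ⟩
          1ℚ * - ε (count true c)
            ≡⟨ solve 1 (λ x → con 1ℚ :* :- x := :- (con 1ℚ :* x)) refl (ε (count true c)) ⟩
          - (1ℚ * ε (count true c))
            ≡⟨ cong (λ d → - (d * ε (count true c))) (⟦⟧-yes (coloured? c (σ , o)) coloured) ⟨
          - (⟦ coloured? c (σ , o) ⟧ * ε (count true c)) ∎
        odd-uncoloured : ∀ c → ¬ IsColoured c (σ , o) → Odd c
        odd-uncoloured c ¬coloured = begin
          ⟦ coloured? (toggle c) (σ , o) ⟧ * ε (count true (toggle c))
            -- If the recoloured vector were admissible, a second toggle would make `c` admissible.
            ≡⟨ cong (_* ε (count true (toggle c))) (⟦⟧-no (coloured? (toggle c) (σ , o)) λ coloured →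
                 ¬coloured (subst (λ c → IsColoured c (σ , o)) (toggle² c) (toggle-coloured (toggle c) coloured))) ⟩
          0ℚ * ε (count true (toggle c))
            ≡⟨ solve 2 (λ x y → con 0ℚ :* x := :- (con 0ℚ :* y)) refl (ε (count true (toggle c))) (ε (count true c)) ⟩
          - (0ℚ * ε (count true c))
            ≡⟨ cong (λ d → - (d * ε (count true c))) (⟦⟧-no (coloured? c (σ , o)) ¬coloured) ⟨
          - (⟦ coloured? c (σ , o) ⟧ * ε (count true c)) ∎

    -- Without arcs every arch is a source, which leaves one colouring. It is the all-true vector
    -- toggled at the arch of 1, so `ε-toggle` yields its sign.
    colourSum-no-arc : (∀ a b → ¬ Arc σ o a b) → colourSum (σ , o) ≡ - ε (suc m)
    colourSum-no-arc no-arc = trans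
      (∑-unique (λ c → coloured? c (σ , o)) (λ c → ε (count true c)) c* coloured* only)
      (trans (ε-toggle ones (sym (lookup-replicate t true)))
             (cong (-_ ∘ ε) (count-replicate (suc m))))
      where
      t = partner σ zero
      open Toggle zero t (partner≢ zero)
      ones = replicate (suc m) true
      c* = toggle ones

      at-0 : lookup c* zero ≡ false
      at-0 = toggle-first ones
      at-t : lookup c* t ≡ false
      at-t = trans (toggle-second ones) (cong not (lookup-replicate t true))
      elsewhere : ∀ {i} → i ≢ zero → i ≢ t → lookup c* i ≡ true
      elsewhere {i} i≢0 i≢t = trans (toggle-other ones i≢0 i≢t) (lookup-replicate i true)

      coloured* : IsColoured c* (σ , o)
      coloured* = matching , orientation , acyclic , source₀ , colour-invariant , (λ i _ j → no-arc i j) , first , sources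
        where
        colour-invariant : ∀ i → lookup c* (partner σ i) ≡ lookup c* i
        colour-invariant i with i Fin.≟ zero | i Fin.≟ t
        ... | yes refl | _        = trans at-t (sym at-0)
        ... | no _     | yes refl = trans (cong (lookup c*) (proj₂ (matching zero))) (trans at-0 (sym at-t))
        ... | no i≢0   | no i≢t   = trans
          (elsewhere (i≢t ∘ partner-flip) (λ eq → i≢0 (trans (partner-flip eq) (proj₂ (matching zero)))))
          (sym (elsewhere i≢0 i≢t))
        first : ∀ v → toℕ v ≡ 0 → lookup c* v ≡ false
        first zero _ = at-0
        sources : ∀ v → IsArch σ v → IsSource σ o v → lookup c* v ≡ false → toℕ v ≡ 0
        sources v arch _ eq with v Fin.≟ zero | v Fin.≟ t
        ... | yes refl | _        = refl
        ... | no _     | yes refl with () ← subst (t Fin.<_) (proj₂ (matching zero)) arch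
        ... | no v≢0   | no v≢t   with () ← trans (sym (elsewhere v≢0 v≢t)) eq

      only : ∀ c → IsColoured c (σ , o) → c ≡ c*
      only c (_ , _ , _ , _ , colour-invariant , _ , first , sources) = lookup-ext same
        where
        false⇒arch-0 : ∀ i → lookup c i ≡ false → IsArch σ i → toℕ i ≡ 0
        false⇒arch-0 i eq arch = sources i arch (λ b → no-arc b i) eq
        same : ∀ i → lookup c i ≡ lookup c* i
        same i with i Fin.≟ zero | i Fin.≟ t
        ... | yes refl | _        = trans (first zero refl) (sym at-0)
        ... | no _     | yes refl = trans (colour-invariant zero) (trans (first zero refl) (sym at-t))
        ... | no i≢0   | no i≢t   = trans (Bool.¬-not is-true) (sym (elsewhere i≢0 i≢t))
          where
          is-true : lookup c i ≢ false
          is-true eq with i Fin.<? partner σ i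
          ... | yes arch = i≢0 (Fin.toℕ-injective (false⇒arch-0 i eq arch))
          -- A right endpoint is treated through its left one, which has the same colour and would
          -- have to be the point 1.
          ... | no ¬arch = i≢t (partner-flip (Fin.toℕ-injective
            (false⇒arch-0 (partner σ i) (trans (colour-invariant i) eq)
              (subst (partner σ i Fin.<_) (sym (proj₂ (matching i)))
                (ℕ.≤∧≢⇒< (ℕ.≮⇒≥ ¬arch) (proj₁ (matching i) ∘ Fin.toℕ-injective))))))

  -- The conditions decided first are those of `IsColoured` that do not mention the colours. An
  -- arcless configuration satisfies them, so if they fail both sides vanish; if they hold and there
  -- is no arc, there is no crossing either, since each crossing would be oriented.
  colourSum-value : ∀ {m} (x : Configuration (suc m)) → colourSum x ≡ - ε (suc m) * ⟦ arcless? x ⟧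
  colourSum-value {m} (σ , o)
    with matching? σ ×-dec (orientation? σ o ×-dec (acyclic? σ o ×-dec (all? λ v → (toℕ v ℕ.≟ 0) →-dec source? σ o v)))
  ... | no ¬base = trans
    (∑-0 λ c → trans (cong (_* ε (count true c)) (⟦⟧-no (coloured? c (σ , o))
      λ (p , q , r , s , _) → ¬base (p , q , r , s))) (*-zeroˡ (ε (count true c))))
    (sym (trans (cong (- ε (suc m) *_) (⟦⟧-no (arcless? (σ , o)) λ ((matching , noncrossing) , no-arc) →
      ¬base (matching , ((λ a b r → ⊥-elim (no-arc a b r)) ,
                         (λ { a b (inj₁ x) → ⊥-elim (noncrossing a b x) ; a b (inj₂ x) → ⊥-elim (noncrossing b a x) })) ,
             no-cycle no-arc , λ v _ b → no-arc b v)))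
      (*-zeroʳ (- ε (suc m)))))
    where
    no-cycle : (∀ a b → ¬ Arc σ o a b) → IsAcyclic σ o
    no-cycle no-arc a [ r ]   = no-arc _ _ r
    no-cycle no-arc a (r ∷ _) = no-arc _ _ r
  ... | yes (matching , orientation , acyclic , source₀) with any? (λ a → any? (λ b → arc? σ o a b))
  ...   | yes (a , b , r) = trans (colourSum-arc σ o matching orientation acyclic source₀ r)
    (sym (trans (cong (- ε (suc m) *_) (⟦⟧-no (arcless? (σ , o)) λ (_ , no-arc) → no-arc a b r))
                (*-zeroʳ (- ε (suc m)))))
  ...   | no ∄arc = trans (colourSum-no-arc σ o matching orientation acyclic source₀ no-arc)
    (sym (trans (cong (- ε (suc m) *_) (⟦⟧-yes (arcless? (σ , o)) ((matching , noncrossing) , no-arc)))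
                (*-identityʳ (- ε (suc m)))))
    where
    no-arc : ∀ a b → ¬ Arc σ o a b
    no-arc a b r = ∄arc (a , b , r)
    noncrossing : ∀ a b → ¬ Cross σ a b
    noncrossing a b x with proj₂ orientation a b (inj₁ x)
    ... | inj₁ (r , _) = no-arc a b r
    ... | inj₂ (r , _) = no-arc b a r

  ∑-arcless : ∀ N → ∑ {Configuration N} (λ x → ⟦ arcless? x ⟧) ≡ noncrossingCount N
  ∑-arcless N = ∑-bijection arcless? noncrossing? proj₁ (_, replicate N (replicate N false))
    (λ (σ , o) (noncrossing , no-arc) → noncrossing , cong (σ ,_) (matrix-ext λ i j →
      trans (no-arcs i j) (sym (Bool.¬-not (no-arc i j)))))
    (λ σ noncrossing → (noncrossing , λ i j r → false≢true (trans (sym (no-arcs i j)) r)) , refl)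
    where
    false≢true : false ≢ true
    false≢true ()
    no-arcs : ∀ i j → lookup (lookup (replicate N (replicate N false)) i) j ≡ false
    no-arcs i j = trans (cong (λ v → lookup v j) (lookup-replicate i (replicate N false))) (lookup-replicate j false)

-- Noncrossing matchings with open ends, grown from the right

module Noncrossing where

  open import Defs
  open FiniteSums
  open Matchings
  open Split using (noncrossingCount; lookup-ext)
  open import Data.Empty using (⊥-elim)
  open import Data.Fin as Fin using (Fin; zero; suc; toℕ)
  open import Data.Fin.Properties as Fin using (all?; any?)
  open import Data.Maybe as Maybe using (Maybe; just; nothing; fromMaybe)
  import Data.Maybe.Properties as Maybe
  open import Data.Nat as ℕ using (ℕ; zero; suc; s≤s; z≤n)
  import Data.Nat.Properties as ℕ
  open import Data.Product using (∃; _×_; _,_; proj₁; proj₂)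
  open import Data.Rational using (ℚ; 0ℚ; 1ℚ; _+_)
  open import Data.Rational.Properties using (+-identityˡ)
  open import Data.Vec as Vec using (Vec; []; _∷_; lookup; tabulate; updateAt; head; tail)
  open import Data.Vec.Properties using (lookup-map; lookup∘tabulate; lookup∘updateAt; lookup∘updateAt′)
  open import Function using (_∘_; const)
  open import Relation.Binary using (tri<; tri≈; tri>)
  open import Relation.Binary.PropositionalEquality
  open import Relation.Nullary using (Dec; yes; no; ¬_)
  open import Relation.Nullary.Decidable using (¬?; _×-dec_; _→-dec_)

  -- A partial matching of points that are joined to each other (just) or to points further
  -- to the left (nothing); no arch passes above a point joined to the left.
  Partial : ℕ → Set
  Partial N = Vec (Maybe (Fin N)) N

  private variable
    N : ℕ
    τ : Partial N

  -- The second condition combines two: a point strictly under an arch is not open, and its partner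
  -- lies under the same arch, so nothing crosses.
  IsPartial : Partial N → Set
  IsPartial {N} τ =
    (∀ i j → lookup τ i ≡ just j → i ≢ j × lookup τ j ≡ just i) ×
    (∀ i j → lookup τ i ≡ just j → ∀ k → i Fin.< k → k Fin.< j →
       ∃ λ l → lookup τ k ≡ just l × i Fin.< l × l Fin.< j)

  stubs : ∀ {A : Set} {n} → Vec (Maybe A) n → ℕ
  stubs []            = 0
  stubs (nothing ∷ τ) = suc (stubs τ)
  stubs (just _  ∷ τ) = stubs τ

  opaque
    partial? : ∀ h (τ : Partial N) → Dec (IsPartial τ × stubs τ ≡ h)
    partial? h τ =
      ((all? λ i → all? λ j → Maybe.≡-dec Fin._≟_ (lookup τ i) (just j) →-dec
         (¬? (i Fin.≟ j) ×-dec Maybe.≡-dec Fin._≟_ (lookup τ j) (just i))) ×-dec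
       (all? λ i → all? λ j → Maybe.≡-dec Fin._≟_ (lookup τ i) (just j) →-dec
         (all? λ k → (i Fin.<? k) →-dec ((k Fin.<? j) →-dec
           (any? λ l → Maybe.≡-dec Fin._≟_ (lookup τ k) (just l) ×-dec ((i Fin.<? l) ×-dec (l Fin.<? j))))))) ×-dec
      (stubs τ ℕ.≟ h)

  -- The ballot numbers: read from right to left, an open end or a right endpoint is a step up and a
  -- left endpoint a step down, for a nonnegative path of `N` steps ending at height `h`.
  ballot : ℕ → ℕ → ℚ
  ballot N h = ∑ {Partial N} λ τ → ⟦ partial? h τ ⟧

  raise : Maybe (Fin N) → Maybe (Fin (suc N))
  raise = Maybe.map suc

  -- A point joined to the removed position `zero` becomes an open end.
  low : Maybe (Fin (suc N)) → Maybe (Fin N)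
  low (just (suc i)) = just i
  low _              = nothing

  low-just : ∀ (x : Maybe (Fin (suc N))) {i} → low x ≡ just i → x ≡ just (suc i)
  low-just (just (suc i)) refl = refl

  lower : Partial (suc N) → Partial N
  lower τ = Vec.map low (tail τ)

  insert : Maybe (Fin N) → Partial N → Partial (suc N)
  insert nothing  τ = nothing ∷ Vec.map raise τ
  insert (just j) τ = just (suc j) ∷ updateAt (Vec.map raise τ) j (const (just zero))

  lookup-lower : ∀ (τ : Partial (suc N)) i → lookup (lower τ) i ≡ low (lookup τ (suc i))
  lookup-lower (_ ∷ τ) i = lookup-map i low τ

  lookup-insert-≢ : ∀ (τ : Partial N) {j} i → i ≢ j → lookup (insert (just j) τ) (suc i) ≡ raise (lookup τ i)
  lookup-insert-≢ τ {j} i i≢j = trans (lookup∘updateAt′ i j i≢j (Vec.map raise τ)) (lookup-map i raise τ)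

  lookup-insert-≡ : ∀ (τ : Partial N) j → lookup (insert (just j) τ) (suc j) ≡ just zero
  lookup-insert-≡ τ j = lookup∘updateAt j (Vec.map raise τ)

  low-raise : ∀ (x : Maybe (Fin N)) → low (raise x) ≡ x
  low-raise nothing  = refl
  low-raise (just _) = refl

  raise-just : ∀ (x : Maybe (Fin N)) {j} → raise x ≡ just j → ∃ λ i → x ≡ just i × j ≡ suc i
  raise-just (just i) refl = i , refl , refl

  raise-low : ∀ (x : Maybe (Fin (suc N))) → x ≢ just zero → raise (low x) ≡ x
  raise-low nothing        _   = refl
  raise-low (just zero)    x≢0 = ⊥-elim (x≢0 refl)
  raise-low (just (suc i)) _   = refl

  stubs-raise : ∀ {n} (τ : Vec (Maybe (Fin N)) n) → stubs (Vec.map raise τ) ≡ stubs τ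
  stubs-raise []            = refl
  stubs-raise (nothing ∷ τ) = cong suc (stubs-raise τ)
  stubs-raise (just _  ∷ τ) = stubs-raise τ

  stubs-update : ∀ {A : Set} {n} (τ : Vec (Maybe A) n) j {x} → lookup τ j ≡ nothing →
                 suc (stubs (updateAt τ j (const (just x)))) ≡ stubs τ
  stubs-update (nothing ∷ τ) zero    _  = refl
  stubs-update (nothing ∷ τ) (suc j) eq = cong suc (stubs-update τ j eq)
  stubs-update (just _  ∷ τ) (suc j) eq = stubs-update τ j eq

  stubs-insert : ∀ (τ : Partial N) j → lookup τ j ≡ nothing → suc (stubs (insert (just j) τ)) ≡ stubs τ
  stubs-insert τ j eq = trans (stubs-update (Vec.map raise τ) j (trans (lookup-map j raise τ) (cong raise eq)))
                              (stubs-raise τ)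

  firstStub : ∀ {A : Set} {n} → Vec (Maybe A) n → Maybe (Fin n)
  firstStub []            = nothing
  firstStub (nothing ∷ τ) = just zero
  firstStub (just _  ∷ τ) = Maybe.map suc (firstStub τ)

  firstStub-exists : ∀ {A : Set} {n h} (τ : Vec (Maybe A) n) → stubs τ ≡ suc h → ∃ λ j → firstStub τ ≡ just j
  firstStub-exists (nothing ∷ τ) _  = zero , refl
  firstStub-exists (just _  ∷ τ) eq = let (j , found) = firstStub-exists τ eq in suc j , cong (Maybe.map suc) found

  firstStub-sound : ∀ {A : Set} {n} (τ : Vec (Maybe A) n) {j} → firstStub τ ≡ just j →
                    lookup τ j ≡ nothing × (∀ k → k Fin.< j → lookup τ k ≢ nothing)
  firstStub-sound (nothing ∷ τ) refl = refl , λ _ ()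
  firstStub-sound (just _  ∷ τ) eq with firstStub τ in found
  firstStub-sound (just _  ∷ τ) refl | just j = let (stub , first) = firstStub-sound τ found in
    stub , λ { zero _ () ; (suc k) (s≤s k<j) → first k k<j }

  firstStub-unique : ∀ {A : Set} {n} (τ : Vec (Maybe A) n) j → lookup τ j ≡ nothing →
                     (∀ k → k Fin.< j → lookup τ k ≢ nothing) → firstStub τ ≡ just j
  firstStub-unique (nothing ∷ τ) zero    _  _     = refl
  firstStub-unique (nothing ∷ τ) (suc j) _  first = ⊥-elim (first zero (s≤s z≤n) refl)
  firstStub-unique (just _  ∷ τ) (suc j) eq first =
    cong (Maybe.map suc) (firstStub-unique τ j eq (λ k k<j → first (suc k) (s≤s k<j)))

  partial-lower : ∀ (τ : Partial (suc N)) → IsPartial τ → IsPartial (lower τ)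
  partial-lower τ (symmetric , nested) = symmetric′ , nested′
    where
    up : ∀ {i j} → lookup (lower τ) i ≡ just j → lookup τ (suc i) ≡ just (suc j)
    up {i} eq = low-just (lookup τ (suc i)) (trans (sym (lookup-lower τ i)) eq)
    down : ∀ {i j} → lookup τ (suc i) ≡ just (suc j) → lookup (lower τ) i ≡ just j
    down {i} eq = trans (lookup-lower τ i) (cong low eq)
    symmetric′ : ∀ i j → lookup (lower τ) i ≡ just j → i ≢ j × lookup (lower τ) j ≡ just i
    symmetric′ i j eq = let (i≢j , back) = symmetric (suc i) (suc j) (up eq) in i≢j ∘ cong suc , down back
    nested′ : ∀ i j → lookup (lower τ) i ≡ just j → ∀ k → i Fin.< k → k Fin.< j →
              ∃ λ l → lookup (lower τ) k ≡ just l × i Fin.< l × l Fin.< j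
    nested′ i j eq k i<k k<j with nested (suc i) (suc j) (up eq) (suc k) (s≤s i<k) (s≤s k<j)
    ... | suc l , eq′ , s≤s i<l , s≤s l<j = l , down eq′ , i<l , l<j

  partial-insert-nothing : ∀ (τ : Partial N) → IsPartial τ → IsPartial (insert nothing τ)
  partial-insert-nothing τ (symmetric , nested) = symmetric′ , nested′
    where
    τ⁺ = insert nothing τ
    up : ∀ {i j} → lookup τ i ≡ just j → lookup τ⁺ (suc i) ≡ just (suc j)
    up {i} eq = trans (lookup-map i raise τ) (cong raise eq)
    down : ∀ {i j} → lookup τ⁺ (suc i) ≡ just j → ∃ λ j′ → lookup τ i ≡ just j′ × j ≡ suc j′
    down {i} eq = raise-just (lookup τ i) (trans (sym (lookup-map i raise τ)) eq)
    symmetric′ : ∀ i j → lookup τ⁺ i ≡ just j → i ≢ j × lookup τ⁺ j ≡ just i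
    symmetric′ (suc i) j eq with down eq
    ... | j′ , eq′ , refl = let (i≢j , back) = symmetric i j′ eq′ in i≢j ∘ Fin.suc-injective , up back
    nested′ : ∀ i j → lookup τ⁺ i ≡ just j → ∀ k → i Fin.< k → k Fin.< j →
              ∃ λ l → lookup τ⁺ k ≡ just l × i Fin.< l × l Fin.< j
    nested′ (suc i) j eq (suc k) (s≤s i<k) k<j with down eq
    nested′ (suc i) _ eq (suc k) (s≤s i<k) (s≤s k<j) | j′ , eq′ , refl =
      let (l , eq″ , i<l , l<j) = nested i j′ eq′ k i<k k<j in suc l , up eq″ , s≤s i<l , s≤s l<j

  -- Every point before the first open end `j` is joined, and to a point before `j`: the partner
  -- cannot be `j` itself, and beyond `j` its arch would cover an open end.
  partial-insert-just : ∀ (τ : Partial N) j → lookup τ j ≡ nothing → (∀ k → k Fin.< j → lookup τ k ≢ nothing) →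
                        IsPartial τ → IsPartial (insert (just j) τ)
  partial-insert-just {N} τ j stub first (symmetric , nested) = symmetric′ , nested′
    where
    τ⁺ = insert (just j) τ
    joined⇒≢ : ∀ {i l} → lookup τ i ≡ just l → i ≢ j
    joined⇒≢ eq refl with () ← trans (sym stub) eq
    up : ∀ {i l} → lookup τ i ≡ just l → lookup τ⁺ (suc i) ≡ just (suc l)
    up {i} eq = trans (lookup-insert-≢ τ i (joined⇒≢ eq)) (cong raise eq)
    down : ∀ {i l} → i ≢ j → lookup τ⁺ (suc i) ≡ just l → ∃ λ l′ → lookup τ i ≡ just l′ × l ≡ suc l′
    down {i} i≢j eq = raise-just (lookup τ i) (trans (sym (lookup-insert-≢ τ i i≢j)) eq)
    before : ∀ k → k Fin.< j → ∃ λ l → lookup τ k ≡ just l × l Fin.< j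
    before k k<j with lookup τ k in eq
    ... | nothing = ⊥-elim (first k k<j eq)
    ... | just l with Fin.<-cmp l j
    ...   | tri< l<j _ _  = l , refl , l<j
    ...   | tri≈ _ refl _ with () ← trans (sym stub) (proj₂ (symmetric k l eq))
    ...   | tri> _ _ j<l with () ← trans (sym stub) (proj₁ (proj₂ (nested k l eq j k<j j<l)))
    symmetric′ : ∀ i l → lookup τ⁺ i ≡ just l → i ≢ l × lookup τ⁺ l ≡ just i
    symmetric′ zero    _ refl = (λ ()) , lookup-insert-≡ τ j
    symmetric′ (suc i) l eq with i Fin.≟ j
    ... | yes refl with refl ← trans (sym (lookup-insert-≡ τ j)) eq = (λ ()) , refl
    ... | no i≢j with down i≢j eq
    ...   | l′ , eq′ , refl = let (i≢l , back) = symmetric i l′ eq′ in i≢l ∘ Fin.suc-injective , up back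
    nested′ : ∀ i l → lookup τ⁺ i ≡ just l → ∀ k → i Fin.< k → k Fin.< l →
              ∃ λ p → lookup τ⁺ k ≡ just p × i Fin.< p × p Fin.< l
    nested′ zero    _ refl (suc k) _ (s≤s k<j) = let (l , eq , l<j) = before k k<j in suc l , up eq , s≤s z≤n , s≤s l<j
    nested′ (suc i) l eq (suc k) (s≤s i<k) k<l with i Fin.≟ j
    ... | yes refl with refl ← trans (sym (lookup-insert-≡ τ j)) eq | () ← k<l
    nested′ (suc i) l eq (suc k) (s≤s i<k) k<l | no i≢j with down i≢j eq
    nested′ (suc i) _ eq (suc k) (s≤s i<k) (s≤s k<l) | no i≢j | l′ , eq′ , refl =
      let (p , eq″ , i<p , p<l) = nested i l′ eq′ k i<k k<l in suc p , up eq″ , s≤s i<p , s≤s p<l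

  lower-insert-nothing : ∀ (τ : Partial N) → lower (insert nothing τ) ≡ τ
  lower-insert-nothing τ = lookup-ext λ i → begin
    lookup (lower (insert nothing τ)) i   ≡⟨ lookup-lower (insert nothing τ) i ⟩
    low (lookup (Vec.map raise τ) i)      ≡⟨ cong low (lookup-map i raise τ) ⟩
    low (raise (lookup τ i))              ≡⟨ low-raise (lookup τ i) ⟩
    lookup τ i ∎
    where open ≡-Reasoning

  lower-insert-just : ∀ (τ : Partial N) j → lookup τ j ≡ nothing → lower (insert (just j) τ) ≡ τ
  lower-insert-just τ j stub = lookup-ext λ i → trans (lookup-lower (insert (just j) τ) i) (at i)
    where
    at : ∀ i → low (lookup (insert (just j) τ) (suc i)) ≡ lookup τ i
    at i with i Fin.≟ j
    ... | yes refl = trans (cong low (lookup-insert-≡ τ j)) (sym stub)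
    ... | no i≢j   = trans (cong low (lookup-insert-≢ τ i i≢j)) (low-raise (lookup τ i))

  insert-nothing-lower : ∀ (τ : Partial (suc N)) → IsPartial τ → head τ ≡ nothing → insert nothing (lower τ) ≡ τ
  insert-nothing-lower τ@(nothing ∷ τ′) (symmetric , _) _ = cong (nothing ∷_) (lookup-ext λ i →
    trans (lookup-map i raise (lower τ)) (trans (cong raise (lookup-lower τ i))
      (raise-low (lookup τ′ i) (not-zero i))))
    where
    not-zero : ∀ i → lookup τ′ i ≢ just zero
    not-zero i eq with () ← proj₂ (symmetric (suc i) zero eq)

  insert-just-lower : ∀ (τ : Partial (suc N)) {j} → IsPartial τ → head τ ≡ just (suc j) → insert (just j) (lower τ) ≡ τ
  insert-just-lower τ@(_ ∷ τ′) {j} (symmetric , _) refl = lookup-ext at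
    where
    at : ∀ i → lookup (insert (just j) (lower τ)) i ≡ lookup τ i
    at zero = refl
    at (suc i) with i Fin.≟ j
    ... | yes refl = trans (lookup-insert-≡ (lower τ) j) (sym (proj₂ (symmetric zero (suc j) refl)))
    ... | no i≢j   = trans (lookup-insert-≢ (lower τ) i i≢j) (trans (cong raise (lookup-lower τ i))
      (raise-low (lookup τ′ i) λ eq →
        i≢j (sym (Fin.suc-injective (Maybe.just-injective (proj₂ (symmetric (suc i) zero eq)))))))

  stub-lower : ∀ (τ : Partial (suc N)) {j} → IsPartial τ → head τ ≡ just (suc j) → lookup (lower τ) j ≡ nothing
  stub-lower τ@(_ ∷ _) {j} (symmetric , _) refl =
    trans (lookup-lower τ j) (cong low (proj₂ (symmetric zero (suc j) refl)))

  -- Points under the arch of `zero` have their partners under it as well, so removing `zero` opens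
  -- none of them.
  firstStub-lower : ∀ (τ : Partial (suc N)) {j} → IsPartial τ → head τ ≡ just (suc j) → firstStub (lower τ) ≡ just j
  firstStub-lower τ@(_ ∷ _) {j} partial@(_ , nested) refl =
    firstStub-unique (lower τ) j (stub-lower τ partial refl) λ k k<j → joined k k<j
    where
    joined : ∀ k → k Fin.< j → lookup (lower τ) k ≢ nothing
    joined k k<j eq with nested zero (suc j) refl (suc k) (s≤s z≤n) (s≤s k<j)
    ... | suc l , eq′ , _ , _ with () ← trans (sym eq) (trans (lookup-lower τ k) (cong low eq′))

  head-nothing? : (τ : Partial (suc N)) → Dec (head τ ≡ nothing)
  head-nothing? τ = Maybe.≡-dec Fin._≟_ (head τ) nothing

  head-just : ∀ (τ : Partial (suc N)) → IsPartial τ → head τ ≢ nothing → ∃ λ j → head τ ≡ just (suc j)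
  head-just (nothing       ∷ τ) _               h≢ = ⊥-elim (h≢ refl)
  head-just (just zero     ∷ τ) (symmetric , _) _  = ⊥-elim (proj₁ (symmetric zero zero refl) refl)
  head-just (just (suc j)  ∷ τ) _               _  = j , refl

  ballot-split : ∀ N h → ballot (suc N) h ≡
    ∑ {Partial (suc N)} (λ τ → ⟦ partial? h τ ×-dec head-nothing? τ ⟧) +
    ∑ {Partial (suc N)} (λ τ → ⟦ partial? h τ ×-dec ¬? (head-nothing? τ) ⟧)
  ballot-split N h = trans (∑-cong {A = Partial (suc N)} split)
    (∑-+ {A = Partial (suc N)} (λ τ → ⟦ partial? h τ ×-dec head-nothing? τ ⟧)
         (λ τ → ⟦ partial? h τ ×-dec ¬? (head-nothing? τ) ⟧))
    where
    split : ∀ τ → ⟦ partial? h τ ⟧ ≡ ⟦ partial? h τ ×-dec head-nothing? τ ⟧ + ⟦ partial? h τ ×-dec ¬? (head-nothing? τ) ⟧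
    split τ with partial? h τ | head-nothing? τ
    ... | no  _ | _     = refl
    ... | yes _ | yes _ = refl
    ... | yes _ | no  _ = refl

  -- Removing a joined leftmost point opens one end, necessarily the first, so the removed arch can
  -- be restored without further data.
  ballot-just : ∀ N h → ∑ {Partial (suc N)} (λ τ → ⟦ partial? h τ ×-dec ¬? (head-nothing? τ) ⟧) ≡ ballot N (suc h)
  ballot-just N h = ∑-bijection {Partial (suc N)} {Partial N} (λ τ → partial? h τ ×-dec ¬? (head-nothing? τ)) (partial? (suc h))
    lower (λ τ → insert (firstStub τ) τ) to from
    where
    to : ∀ τ → (IsPartial τ × stubs τ ≡ h) × head τ ≢ nothing →
         (IsPartial (lower τ) × stubs (lower τ) ≡ suc h) × insert (firstStub (lower τ)) (lower τ) ≡ τ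
    to τ ((partial , stubs≡) , h≢) with head-just τ partial h≢
    ... | j , h≡ = let back = insert-just-lower τ partial h≡ in
      (partial-lower τ partial ,
       trans (sym (stubs-insert (lower τ) j (stub-lower τ partial h≡))) (cong suc (trans (cong stubs back) stubs≡))) ,
      trans (cong (λ x → insert x (lower τ)) (firstStub-lower τ partial h≡)) back
    from : ∀ τ → IsPartial τ × stubs τ ≡ suc h →
           ((IsPartial (insert (firstStub τ) τ) × stubs (insert (firstStub τ) τ) ≡ h) ×
            head (insert (firstStub τ) τ) ≢ nothing) × lower (insert (firstStub τ) τ) ≡ τ
    from τ (partial , stubs≡) with firstStub-exists τ stubs≡
    ... | j , found with firstStub-sound τ found
    ...   | stub , first rewrite found =
      ((partial-insert-just τ j stub first partial , ℕ.suc-injective (trans (stubs-insert τ j stub) stubs≡)) , λ ()) ,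
      lower-insert-just τ j stub

  ballot-suc-zero : ∀ N → ballot (suc N) 0 ≡ ballot N 1
  ballot-suc-zero N = trans (ballot-split N 0) (trans
    (cong₂ _+_ (∑-0 {A = Partial (suc N)} λ τ → ⟦⟧-no (partial? 0 τ ×-dec head-nothing? τ) λ ((_ , stubs≡) , h≡) → no-stub τ stubs≡ h≡)
               (ballot-just N 0))
    (+-identityˡ (ballot N 1)))
    where
    no-stub : ∀ (τ : Partial (suc N)) → stubs τ ≡ 0 → head τ ≢ nothing
    no-stub (just _ ∷ τ) _ ()

  ballot-suc-suc : ∀ N h → ballot (suc N) (suc h) ≡ ballot N h + ballot N (suc (suc h))
  ballot-suc-suc N h = trans (ballot-split N (suc h)) (cong₂ _+_ nothing-first (ballot-just N (suc h)))
    where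
    nothing-first : ∑ {Partial (suc N)} (λ τ → ⟦ partial? (suc h) τ ×-dec head-nothing? τ ⟧) ≡ ballot N h
    nothing-first = ∑-bijection {Partial (suc N)} {Partial N} (λ τ → partial? (suc h) τ ×-dec head-nothing? τ) (partial? h) lower (insert nothing)
      (λ τ ((partial , stubs≡) , h≡) → let back = insert-nothing-lower τ partial h≡ in
        (partial-lower τ partial ,
         ℕ.suc-injective (trans (cong suc (sym (stubs-raise (lower τ)))) (trans (cong stubs back) stubs≡))) , back)
      (λ τ (partial , stubs≡) →
        ((partial-insert-nothing τ partial , cong suc (trans (stubs-raise τ) stubs≡)) , refl) , lower-insert-nothing τ)

  ballot-zero-zero : ballot 0 0 ≡ 1ℚ
  ballot-zero-zero = cong (_+ 0ℚ) (⟦⟧-yes (partial? 0 []) (((λ ()) , λ ()) , refl))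

  ballot-zero-suc : ∀ h → ballot 0 (suc h) ≡ 0ℚ
  ballot-zero-suc h = cong (_+ 0ℚ) (⟦⟧-no (partial? (suc h) []) λ ())

  -- If a point under an arch had its partner outside, the two arches would cross, in an order given
  -- by the side; a partner at an end of the arch contradicts the involution.
  noncrossing⇒partial : ∀ (σ : Vec (Fin N) N) → IsNoncrossing σ → IsPartial (Vec.map just σ)
  noncrossing⇒partial {N} σ (matching , noncrossing) = symmetric , nested
    where
    down : ∀ {i j} → lookup (Vec.map just σ) i ≡ just j → lookup σ i ≡ j
    down {i} eq = Maybe.just-injective (trans (sym (lookup-map i just σ)) eq)
    symmetric : ∀ i j → lookup (Vec.map just σ) i ≡ just j → i ≢ j × lookup (Vec.map just σ) j ≡ just i
    symmetric i j eq with refl ← down eq =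
      (λ eq → proj₁ (matching i) (sym eq)) , trans (lookup-map j just σ) (cong just (proj₂ (matching i)))
    nested : ∀ i j → lookup (Vec.map just σ) i ≡ just j → ∀ k → i Fin.< k → k Fin.< j →
             ∃ λ l → lookup (Vec.map just σ) k ≡ just l × i Fin.< l × l Fin.< j
    nested i j eq k i<k k<j with refl ← down eq = lookup σ k , lookup-map k just σ , above , below
      where
      above : i Fin.< lookup σ k
      above with Fin.<-cmp i (lookup σ k)
      ... | tri< lt _ _ = lt
      ... | tri≈ _ e _  = ⊥-elim (ℕ.<-irrefl (cong toℕ (trans (sym (proj₂ (matching k))) (cong (lookup σ) (sym e)))) k<j)
      ... | tri> _ _ gt = ⊥-elim (noncrossing (lookup σ k) i
        (gt , subst (i Fin.<_) (sym (proj₂ (matching k))) i<k , subst (Fin._< lookup σ i) (sym (proj₂ (matching k))) k<j))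
      below : lookup σ k Fin.< lookup σ i
      below with Fin.<-cmp (lookup σ k) (lookup σ i)
      ... | tri< lt _ _ = lt
      ... | tri≈ _ e _  = ⊥-elim (ℕ.<-irrefl (cong toℕ (trans (sym (proj₂ (matching i)))
        (trans (cong (lookup σ) (sym e)) (proj₂ (matching k))))) i<k)
      ... | tri> _ _ gt = ⊥-elim (noncrossing i k (i<k , k<j , gt))

  stubs-map-just : ∀ {A : Set} {n} (v : Vec A n) → stubs (Vec.map just v) ≡ 0
  stubs-map-just []      = refl
  stubs-map-just (_ ∷ v) = stubs-map-just v

  no-stubs⇒just : ∀ {A : Set} {n} (τ : Vec (Maybe A) n) → stubs τ ≡ 0 → ∀ i → ∃ λ x → lookup τ i ≡ just x
  no-stubs⇒just (just x ∷ τ) _  zero    = x , refl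
  no-stubs⇒just (just x ∷ τ) eq (suc i) = no-stubs⇒just τ eq i

  -- The default `i` stands at open ends and is never taken when there are none.
  complete-partners : Partial N → Vec (Fin N) N
  complete-partners τ = tabulate λ i → fromMaybe i (lookup τ i)

  noncrossingCount-ballot : ∀ N → noncrossingCount N ≡ ballot N 0
  noncrossingCount-ballot N = ∑-bijection {Vec (Fin N) N} {Partial N} noncrossing? (partial? 0) (Vec.map just) complete-partners
    (λ σ noncrossing → (noncrossing⇒partial σ noncrossing , stubs-map-just σ) , lookup-ext λ i →
      trans (lookup∘tabulate (λ i → fromMaybe i (lookup (Vec.map just σ) i)) i) (cong (fromMaybe i) (lookup-map i just σ)))
    from
    where
    from : ∀ τ → IsPartial τ × stubs τ ≡ 0 → IsNoncrossing (complete-partners τ) × Vec.map just (complete-partners τ) ≡ τ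
    from τ ((symmetric , nested) , stubs≡) = (matching , noncrossing) ,
      lookup-ext λ i → trans (lookup-map i just σ) (sym (joined i))
      where
      σ = complete-partners τ
      joined : ∀ i → lookup τ i ≡ just (lookup σ i)
      joined i with no-stubs⇒just τ stubs≡ i
      ... | x , eq = trans eq (cong just (sym (trans (lookup∘tabulate (λ i → fromMaybe i (lookup τ i)) i) (cong (fromMaybe i) eq))))
      matching : IsMatching σ
      matching i = let (i≢ , back) = symmetric i (lookup σ i) (joined i) in
        i≢ ∘ sym , Maybe.just-injective (trans (sym (joined (lookup σ i))) back)
      noncrossing : ∀ a b → ¬ Cross σ a b
      noncrossing a b (a<b , b<pa , pa<pb) with nested a (lookup σ a) (joined a) b a<b b<pa
      ... | l , eq , _ , l<pa with refl ← Maybe.just-injective (trans (sym eq) (joined b)) = ℕ.<-asym l<pa pa<pb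

-- From ballot numbers to Catalan numbers

module Ballot where

  open import Defs using (catalan)
  open FiniteSums
  open Noncrossing
  import Data.Integer as ℤ
  open import Data.Nat as ℕ using (ℕ; zero; suc; s≤s)
  import Data.Nat.Properties as ℕ
  open import Data.Nat.Combinatorics using (_C_; nCk+nC[k+1]≡[n+1]C[k+1]; nCk≡nC[n∸k]; nC1≡n)
  open import Data.Rational using (ℚ; 0ℚ; 1ℚ; _+_; _*_; -_; _/_)
  open import Data.Rational.Properties
  open import Data.Rational.Solver using (module +-*-Solver)
  open import Relation.Binary.PropositionalEquality
  open +-*-Solver using (solve; _:=_; _:+_; _:*_; :-_; con)
  open ≡-Reasoning

  binom : ℕ → ℕ → ℚ
  binom n k = fromℕ (n C k)

  binom-0 : ∀ n → binom n 0 ≡ 1ℚ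
  binom-0 n = fromℕ-1

  pascal : ∀ n k → binom (suc n) (suc k) ≡ binom n k + binom n (suc k)
  pascal n k = trans (cong fromℕ (sym (nCk+nC[k+1]≡[n+1]C[k+1] n k))) (fromℕ-+ (n C k) (n C suc k))

  -- The identity (k+1) C(n,k+1) = (n-k) C(n,k), free of subtraction so that it also holds for k
  -- above n; by induction through Pascal's rule.
  absorption : ∀ n k → fromℕ (suc k) * binom n (suc k) + fromℕ k * binom n k ≡ fromℕ n * binom n k
  absorption zero zero = begin
    fromℕ 1 * fromℕ 0 + fromℕ 0 * fromℕ 1
      ≡⟨ cong₂ (λ x y → x * y + y * x) fromℕ-1 fromℕ-0 ⟩
    0ℚ
      ≡⟨ cong₂ (λ x y → y * x) fromℕ-1 fromℕ-0 ⟨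
    fromℕ 0 * fromℕ 1 ∎
  absorption zero (suc k) = begin
    fromℕ (suc (suc k)) * fromℕ 0 + fromℕ (suc k) * fromℕ 0
      ≡⟨ cong (λ x → fromℕ (suc (suc k)) * x + fromℕ (suc k) * x) fromℕ-0 ⟩
    fromℕ (suc (suc k)) * 0ℚ + fromℕ (suc k) * 0ℚ
      ≡⟨ solve 2 (λ x y → x :* con 0ℚ :+ y :* con 0ℚ := con 0ℚ :* con 0ℚ) refl (fromℕ (suc (suc k))) (fromℕ (suc k)) ⟩
    0ℚ * 0ℚ
      ≡⟨ cong (λ x → x * x) fromℕ-0 ⟨
    fromℕ 0 * fromℕ 0 ∎
  absorption (suc n) zero = begin
    fromℕ 1 * binom (suc n) 1 + fromℕ 0 * binom (suc n) 0
      ≡⟨ cong₂ (λ x y → x * binom (suc n) 1 + y * binom (suc n) 0) fromℕ-1 fromℕ-0 ⟩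
    1ℚ * binom (suc n) 1 + 0ℚ * binom (suc n) 0
      ≡⟨ solve 2 (λ x y → con 1ℚ :* x :+ con 0ℚ :* y := x :* con 1ℚ) refl (binom (suc n) 1) (binom (suc n) 0) ⟩
    binom (suc n) 1 * 1ℚ
      ≡⟨ cong₂ _*_ (cong fromℕ (nC1≡n (suc n))) (sym (binom-0 (suc n))) ⟩
    fromℕ (suc n) * binom (suc n) 0 ∎
  absorption (suc n) (suc i) = begin
    fromℕ (suc (suc i)) * binom (suc n) (suc (suc i)) + fromℕ (suc i) * binom (suc n) (suc i)
      ≡⟨ cong₂ (λ x y → fromℕ (suc (suc i)) * x + fromℕ (suc i) * y) (pascal n (suc i)) (pascal n i) ⟩
    fromℕ (suc (suc i)) * (b₁ + b₂) + fromℕ (suc i) * (b₀ + b₁)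
      ≡⟨ cong₂ (λ x y → x * (b₁ + b₂) + y * (b₀ + b₁)) i+2 (fromℕ-suc i) ⟩
    (1ℚ + (1ℚ + j)) * (b₁ + b₂) + (1ℚ + j) * (b₀ + b₁)
      ≡⟨ solve 4 (λ j b₀ b₁ b₂ →
           (con 1ℚ :+ (con 1ℚ :+ j)) :* (b₁ :+ b₂) :+ (con 1ℚ :+ j) :* (b₀ :+ b₁)
           := ((con 1ℚ :+ (con 1ℚ :+ j)) :* b₂ :+ (con 1ℚ :+ j) :* b₁)
              :+ ((con 1ℚ :+ j) :* b₁ :+ j :* b₀) :+ (b₁ :+ b₀)) refl j b₀ b₁ b₂ ⟩
    ((1ℚ + (1ℚ + j)) * b₂ + (1ℚ + j) * b₁) + ((1ℚ + j) * b₁ + j * b₀) + (b₁ + b₀)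
      ≡⟨ cong₂ (λ x y → (x * b₂ + y * b₁) + (y * b₁ + j * b₀) + (b₁ + b₀)) (sym i+2) (sym (fromℕ-suc i)) ⟩
    (fromℕ (suc (suc i)) * b₂ + fromℕ (suc i) * b₁) + (fromℕ (suc i) * b₁ + j * b₀) + (b₁ + b₀)
      ≡⟨ cong₂ (λ x y → x + y + (b₁ + b₀)) (absorption n (suc i)) (absorption n i) ⟩
    fromℕ n * b₁ + fromℕ n * b₀ + (b₁ + b₀)
      ≡⟨ solve 3 (λ n b₀ b₁ → n :* b₁ :+ n :* b₀ :+ (b₁ :+ b₀) := (con 1ℚ :+ n) :* (b₀ :+ b₁)) refl (fromℕ n) b₀ b₁ ⟩
    (1ℚ + fromℕ n) * (b₀ + b₁)
      ≡⟨ cong₂ _*_ (fromℕ-suc n) (pascal n i) ⟨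
    fromℕ (suc n) * binom (suc n) (suc i) ∎
    where
    j = fromℕ i
    b₀ = binom n i
    b₁ = binom n (suc i)
    b₂ = binom n (suc (suc i))
    i+2 : fromℕ (suc (suc i)) ≡ 1ℚ + (1ℚ + j)
    i+2 = trans (fromℕ-suc (suc i)) (cong (1ℚ +_) (fromℕ-suc i))

  -- binom n k - binom n (k - 1), with binom n (-1) = 0.
  binom-diff : ℕ → ℕ → ℚ
  binom-diff n zero    = binom n 0
  binom-diff n (suc k) = binom n (suc k) + - binom n k

  binom-diff-pascal : ∀ n k → binom-diff (suc n) (suc k) ≡ binom-diff n (suc k) + binom-diff n k
  binom-diff-pascal n zero = begin
    binom (suc n) 1 + - binom (suc n) 0
      ≡⟨ cong₂ (λ x y → x + - y) (pascal n 0) (trans (binom-0 (suc n)) (sym (binom-0 n))) ⟩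
    (binom n 0 + binom n 1) + - binom n 0
      ≡⟨ solve 2 (λ x y → (x :+ y) :+ :- x := (y :+ :- x) :+ x) refl (binom n 0) (binom n 1) ⟩
    (binom n 1 + - binom n 0) + binom n 0 ∎
  binom-diff-pascal n (suc k) = begin
    binom (suc n) (suc (suc k)) + - binom (suc n) (suc k)
      ≡⟨ cong₂ (λ x y → x + - y) (pascal n (suc k)) (pascal n k) ⟩
    (binom n (suc k) + binom n (suc (suc k))) + - (binom n k + binom n (suc k))
      ≡⟨ solve 3 (λ x y z → (y :+ z) :+ :- (x :+ y) := (z :+ :- y) :+ (y :+ :- x)) refl
           (binom n k) (binom n (suc k)) (binom n (suc (suc k))) ⟩
    (binom n (suc (suc k)) + - binom n (suc k)) + (binom n (suc k) + - binom n k) ∎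

  -- The two middle entries of an odd row agree. This is the boundary condition at height -1 for the
  -- ballot recurrence.
  binom-diff-middle : ∀ k → binom-diff (suc (k ℕ.+ k)) (suc k) ≡ 0ℚ
  binom-diff-middle k = trans
    (cong (λ x → binom n (suc k) + - fromℕ x) (trans (nCk≡nC[n∸k] k≤n) (cong (n C_) n∸k)))
    (+-inverseʳ (binom n (suc k)))
    where
    n = suc (k ℕ.+ k)
    k≤n : k ℕ.≤ n
    k≤n = ℕ.m≤n⇒m≤1+n (ℕ.m≤m+n k k)
    n∸k : n ℕ.∸ k ≡ suc k
    n∸k = ℕ.m+n∸n≡m (suc k) k

  ballot-vanish : ∀ N h → N ℕ.< h → ballot N h ≡ 0ℚ
  ballot-vanish zero    (suc h) _         = ballot-zero-suc h
  ballot-vanish (suc N) (suc h) (s≤s N<h) = trans (ballot-suc-suc N h)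
    (cong₂ _+_ (ballot-vanish N h N<h) (ballot-vanish N (suc (suc h)) (ℕ.m≤n⇒m≤1+n (ℕ.m≤n⇒m≤1+n N<h))))

  -- Here `p` is the number of arches. The formula is that of the reflection principle, verified by
  -- showing that both sides obey the same recurrence and boundary conditions.
  ballot-binom : ∀ N h p → N ≡ h ℕ.+ (p ℕ.+ p) → ballot N h ≡ binom-diff N p
  ballot-binom zero zero zero _ = trans ballot-zero-zero (sym (binom-0 0))
  ballot-binom (suc N) zero (suc p) eq = begin
    ballot (suc N) 0                              ≡⟨ ballot-suc-zero N ⟩
    ballot N 1                                    ≡⟨ ballot-binom N 1 p N≡ ⟩
    binom-diff N p                                ≡⟨ +-identityˡ (binom-diff N p) ⟨
    -- Height 0 has a single predecessor; the other summand in Pascal's rule is the zero difference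
    -- in the middle of an odd row.
    0ℚ + binom-diff N p                           ≡⟨ cong (_+ binom-diff N p) (trans
                                                       (cong (λ n → binom-diff n (suc p)) N≡) (binom-diff-middle p)) ⟨
    binom-diff N (suc p) + binom-diff N p         ≡⟨ binom-diff-pascal N p ⟨
    binom-diff (suc N) (suc p) ∎
    where
    N≡ : N ≡ suc (p ℕ.+ p)
    N≡ = trans (ℕ.suc-injective eq) (ℕ.+-suc p p)
  ballot-binom (suc N) (suc h) zero eq = begin
    ballot (suc N) (suc h)                        ≡⟨ ballot-suc-suc N h ⟩
    ballot N h + ballot N (suc (suc h))
      -- Without arches `N` equals `h`, so `N` points cannot carry `h + 2` open ends.
      ≡⟨ cong₂ _+_ (ballot-binom N h zero (ℕ.suc-injective eq)) (ballot-vanish N (suc (suc h)) N<h+2) ⟩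
    binom N 0 + 0ℚ                                ≡⟨ +-identityʳ (binom N 0) ⟩
    binom N 0                                     ≡⟨ trans (binom-0 N) (sym (binom-0 (suc N))) ⟩
    binom (suc N) 0 ∎
    where
    N<h+2 : N ℕ.< suc (suc h)
    N<h+2 = ℕ.m≤n⇒m≤1+n (s≤s (ℕ.≤-reflexive (trans (ℕ.suc-injective eq) (ℕ.+-identityʳ h))))
  ballot-binom (suc N) (suc h) (suc p) eq = begin
    ballot (suc N) (suc h)                        ≡⟨ ballot-suc-suc N h ⟩
    ballot N h + ballot N (suc (suc h))
      ≡⟨ cong₂ _+_ (ballot-binom N h (suc p) (ℕ.suc-injective eq)) (ballot-binom N (suc (suc h)) p N≡) ⟩
    binom-diff N (suc p) + binom-diff N p         ≡⟨ binom-diff-pascal N p ⟨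
    binom-diff (suc N) (suc p) ∎
    where
    N≡ : N ≡ suc (suc h) ℕ.+ (p ℕ.+ p)
    N≡ = trans (ℕ.suc-injective eq) (trans (cong (h ℕ.+_) (cong suc (ℕ.+-suc p p)))
           (trans (ℕ.+-suc h (suc (p ℕ.+ p))) (cong suc (ℕ.+-suc h (p ℕ.+ p)))))

  *-cancelˡ-fromℕ-suc : ∀ n x y → fromℕ (suc n) * x ≡ fromℕ (suc n) * y → x ≡ y
  *-cancelˡ-fromℕ-suc n x y eq = begin
    x                            ≡⟨ invert x ⟨
    r * (fromℕ (suc n) * x)      ≡⟨ cong (r *_) eq ⟩
    r * (fromℕ (suc n) * y)      ≡⟨ invert y ⟩
    y ∎
    where
    r = ℤ.+ 1 / suc n
    invert : ∀ z → r * (fromℕ (suc n) * z) ≡ z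
    invert z = begin
      r * (fromℕ (suc n) * z)    ≡⟨ solve 3 (λ r m z → r :* (m :* z) := (m :* r) :* z) refl r (fromℕ (suc n)) z ⟩
      fromℕ (suc n) * r * z      ≡⟨ cong (_* z) (trans (fromℕ-*-/ 1 n) fromℕ-1) ⟩
      1ℚ * z                     ≡⟨ *-identityˡ z ⟩
      z ∎

  -- For n = k + 1, split off one copy of `B`. Since N = 1 + (k+1) + k, what remains of (k+2)(B - A)
  -- is (k+1) B + k A - N A, which is 0 by absorption.
  central-binom-diff : ∀ n → fromℕ (suc n) * binom-diff (2 ℕ.* n) n ≡ binom (2 ℕ.* n) n
  central-binom-diff zero    = trans (cong (_* binom 0 0) fromℕ-1) (*-identityˡ (binom 0 0))
  central-binom-diff (suc k) = begin
    fromℕ (suc (suc k)) * (B + - A)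
      ≡⟨ cong (_* (B + - A)) (fromℕ-suc (suc k)) ⟩
    (1ℚ + f) * (B + - A)
      ≡⟨ solve 4 (λ f g A B → (con 1ℚ :+ f) :* (B :+ :- A) := B :+ ((f :* B :+ g :* A) :+ :- ((con 1ℚ :+ f :+ g) :* A)))
           refl f (fromℕ k) A B ⟩
    B + ((f * B + fromℕ k * A) + - ((1ℚ + f + fromℕ k) * A))
      ≡⟨ cong₂ (λ x y → B + (x + - (y * A))) (absorption N k) total ⟩
    B + (fromℕ N * A + - (fromℕ N * A))
      ≡⟨ solve 2 (λ x y → x :+ (y :+ :- y) := x) refl B (fromℕ N * A) ⟩
    B ∎
    where
    N = 2 ℕ.* suc k
    A = binom N k
    B = binom N (suc k)
    f = fromℕ (suc k)
    total : 1ℚ + f + fromℕ k ≡ fromℕ N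
    total = begin
      1ℚ + f + fromℕ k                    ≡⟨ cong (_+ fromℕ k) (fromℕ-suc (suc k)) ⟨
      fromℕ (suc (suc k)) + fromℕ k       ≡⟨ fromℕ-+ (suc (suc k)) k ⟨
      fromℕ (suc (suc k) ℕ.+ k)           ≡⟨ cong fromℕ (cong suc (trans (cong suc (cong (k ℕ.+_) (sym (ℕ.+-identityʳ k))))
                                               (sym (ℕ.+-suc k (k ℕ.+ 0))))) ⟩
      fromℕ N ∎

  ballot-catalan : ∀ n → ballot (2 ℕ.* n) 0 ≡ catalan n
  ballot-catalan n = *-cancelˡ-fromℕ-suc n (ballot (2 ℕ.* n) 0) (catalan n) (begin
    fromℕ (suc n) * ballot (2 ℕ.* n) 0
      ≡⟨ cong (fromℕ (suc n) *_) (ballot-binom (2 ℕ.* n) 0 n (cong (n ℕ.+_) (ℕ.+-identityʳ n))) ⟩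
    fromℕ (suc n) * binom-diff (2 ℕ.* n) n
      ≡⟨ central-binom-diff n ⟩
    binom (2 ℕ.* n) n
      ≡⟨ fromℕ-*-/ ((2 ℕ.* n) C n) n ⟨
    fromℕ (suc n) * catalan n ∎)

-- The recurrence for the pairs and the comparison with the logarithm

module Cumulants where

  open import Defs
  open FiniteSums
  open ShuffleProduct
  open LogSeries
  open Matchings
  open Split
  open Peel
  open Noncrossing
  open Ballot
  open import Data.Bool using (Bool; true; false)
  open import Data.Fin using (Fin)
  open import Data.Integer as ℤ using (ℤ)
  open import Data.Nat as ℕ using (ℕ; zero; suc; _!; _%_; NonZero)
  import Data.Nat.DivMod as ℕ
  import Data.Nat.Properties as ℕ
  open import Data.Product using (∃; _,_)
  open import Data.Rational using (ℚ; 0ℚ; 1ℚ; _+_; _*_; -_; _/_)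
  open import Data.Rational.Properties
  open import Data.Rational.Solver using (module +-*-Solver)
  open import Data.Sum using (_⊎_; inj₁; inj₂)
  open import Data.Vec using (Vec; _∷_)
  open import Relation.Binary.PropositionalEquality
  open +-*-Solver using (solve; _:=_; _:+_; _:*_; :-_; con)
  open ≡-Reasoning

  signedNoncrossing : Series
  signedNoncrossing N = ε N * noncrossingCount N

  -- The derivative on `goodCount` reserves the point 1 for the oriented part; the product colours
  -- the other `m` points.
  good-recurrence : D goodCount ⊗ signedNoncrossing ≗ (- 1ℚ) ⊙ D signedNoncrossing
  good-recurrence m = begin
    (D goodCount ⊗ signedNoncrossing) m
      ≡⟨ ∑-colourings (D goodCount) signedNoncrossing m ⟨
    ∑ {Vec Bool m} (λ c → goodCount (suc (count false c)) * (ε (count true c) * noncrossingCount (count true c)))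
      ≡⟨ ∑-cong {A = Vec Bool m} (λ c → colour-false c) ⟨
    ∑ {Vec Bool m} (λ c → colourTerm (false ∷ c))
      ≡⟨ +-identityʳ (∑ {Vec Bool m} (λ c → colourTerm (false ∷ c))) ⟨
    ∑ {Vec Bool m} (λ c → colourTerm (false ∷ c)) + 0ℚ
      -- Colourings with 1 coloured true admit no configuration. Adding their zero terms gives a sum
      -- over all colourings, which can be exchanged with the sum over configurations.
      ≡⟨ cong (∑ {Vec Bool m} (λ c → colourTerm (false ∷ c)) +_) (∑-0 {A = Vec Bool m} colour-true) ⟨
    ∑ {Vec Bool m} (λ c → colourTerm (false ∷ c)) + ∑ {Vec Bool m} (λ c → colourTerm (true ∷ c))
      ≡⟨ ∑-Vec-Bool-suc {m} colourTerm ⟨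
    ∑ {Vec Bool (suc m)} colourTerm
      ≡⟨ ∑-swap {A = Vec Bool (suc m)} {B = Configuration (suc m)} (λ c x → ⟦ coloured? c x ⟧ * ε (count true c)) ⟩
    ∑ {Configuration (suc m)} colourSum
      ≡⟨ ∑-cong {A = Configuration (suc m)} colourSum-value ⟩
    ∑ {Configuration (suc m)} (λ x → - ε (suc m) * ⟦ arcless? x ⟧)
      ≡⟨ ∑-*ˡ {A = Configuration (suc m)} (- ε (suc m)) (λ x → ⟦ arcless? x ⟧) ⟩
    - ε (suc m) * ∑ {Configuration (suc m)} (λ x → ⟦ arcless? x ⟧)
      ≡⟨ cong (- ε (suc m) *_) (∑-arcless (suc m)) ⟩
    - ε (suc m) * noncrossingCount (suc m)
      ≡⟨ solve 2 (λ x y → (:- x) :* y := con (- 1ℚ) :* (x :* y)) refl (ε (suc m)) (noncrossingCount (suc m)) ⟩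
    - 1ℚ * signedNoncrossing (suc m) ∎
    where
    colourTerm : Vec Bool (suc m) → ℚ
    colourTerm c = ∑ {Configuration (suc m)} (λ x → ⟦ coloured? c x ⟧ * ε (count true c))
    factor : ∀ c → colourTerm c ≡ ε (count true c) * ∑ {Configuration (suc m)} (λ x → ⟦ coloured? c x ⟧)
    factor c = trans
      (∑-cong {A = Configuration (suc m)} (λ x → *-comm ⟦ coloured? c x ⟧ (ε (count true c))))
      (∑-*ˡ {A = Configuration (suc m)} (ε (count true c)) (λ x → ⟦ coloured? c x ⟧))
    colour-false : ∀ c → colourTerm (false ∷ c) ≡
      goodCount (suc (count false c)) * (ε (count true c) * noncrossingCount (count true c))
    colour-false c = trans (factor (false ∷ c)) (trans (cong (ε (count true c) *_) (∑-coloured c))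
      (solve 3 (λ x y z → x :* (y :* z) := y :* (x :* z)) refl
         (ε (count true c)) (goodCount (suc (count false c))) (noncrossingCount (count true c))))
    colour-true : ∀ c → colourTerm (true ∷ c) ≡ 0ℚ
    colour-true c = ∑-0 {A = Configuration (suc m)} λ x → trans
      (cong (_* ε (suc (count true c))) (⟦⟧-no (coloured? (true ∷ c) x)
        λ (_ , _ , _ , _ , _ , _ , first , _) → true≢false (first Fin.zero refl)))
      (*-zeroˡ (ε (suc (count true c))))
      where
      true≢false : true ≢ false
      true≢false ()

  even-or-odd : ∀ m → ∃ λ n → (m ≡ 2 ℕ.* n) ⊎ (m ≡ suc (2 ℕ.* n))
  even-or-odd zero = 0 , inj₁ refl
  even-or-odd (suc m) with even-or-odd m
  ... | n , inj₁ refl = n , inj₂ refl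
  ... | n , inj₂ refl = suc n , inj₁ (cong suc (sym (ℕ.+-suc n (n ℕ.+ 0))))

  2*suc : ∀ n → 2 ℕ.* suc n ≡ suc (suc (2 ℕ.* n))
  2*suc n = cong suc (ℕ.+-suc n (n ℕ.+ 0))

  ε-even : ∀ n → ε (2 ℕ.* n) ≡ sgn n
  ε-even zero    = refl
  ε-even (suc n) = trans (cong ε (2*suc n)) (cong -_ (ε-even n))

  ε-odd : ∀ n → ε (suc (2 ℕ.* n)) ≡ 0ℚ
  ε-odd zero    = refl
  ε-odd (suc n) = trans (cong (λ k → ε (suc k)) (2*suc n)) (cong -_ (ε-odd n))

  fromℕ-*-1/ : ∀ k .{{_ : NonZero k}} → fromℕ k * (ℤ.+ 1 / k) ≡ 1ℚ
  fromℕ-*-1/ (suc k) = trans (fromℕ-*-/ 1 k) fromℕ-1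

  Mser-even : ∀ m → m % 2 ≡ 0 → egf Mser m ≡ sgn (m ℕ./ 2) * catalan (m ℕ./ 2)
  Mser-even m eq with m % 2
  Mser-even m refl | zero = begin
    fromℕ (m !) * (s * (c * r))    ≡⟨ solve 4 (λ k s c r → k :* (s :* (c :* r)) := (k :* r) :* (s :* c)) refl
                                        (fromℕ (m !)) s c r ⟩
    fromℕ (m !) * r * (s * c)      ≡⟨ cong (_* (s * c)) (fromℕ-*-1/ (m !)) ⟩
    1ℚ * (s * c)                   ≡⟨ *-identityˡ (s * c) ⟩
    s * c ∎
    where
    instance _ = ℕ._!≢0 m
    s = sgn (m ℕ./ 2)
    c = catalan (m ℕ./ 2)
    r = ℤ.+ 1 / (m !)

  Mser-odd : ∀ m → m % 2 ≡ 1 → Mser m ≡ 0ℚ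
  Mser-odd m eq with m % 2
  Mser-odd m refl | suc zero = refl

  -- At even indices the factorials cancel and the Catalan number is the number of noncrossing
  -- matchings; at odd ones both sides vanish, the right one through `ε`.
  egf-Mser : egf Mser ≗ signedNoncrossing
  egf-Mser m with even-or-odd m
  ... | n , inj₁ refl = begin
    egf Mser (2 ℕ.* n)
      ≡⟨ Mser-even (2 ℕ.* n) (trans (cong (_% 2) (ℕ.*-comm 2 n)) (ℕ.m*n%n≡0 n 2)) ⟩
    sgn (2 ℕ.* n ℕ./ 2) * catalan (2 ℕ.* n ℕ./ 2)
      ≡⟨ cong (λ k → sgn k * catalan k) (trans (cong (ℕ._/ 2) (ℕ.*-comm 2 n)) (ℕ.m*n/n≡m n 2)) ⟩
    sgn n * catalan n
      ≡⟨ cong₂ _*_ (ε-even n) (trans (noncrossingCount-ballot (2 ℕ.* n)) (ballot-catalan n)) ⟨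
    signedNoncrossing (2 ℕ.* n) ∎
  ... | n , inj₂ refl = begin
    fromℕ (suc (2 ℕ.* n) !) * Mser (suc (2 ℕ.* n))
      ≡⟨ cong (fromℕ (suc (2 ℕ.* n) !) *_) (Mser-odd (suc (2 ℕ.* n))
           (trans (cong (λ k → suc k % 2) (ℕ.*-comm 2 n)) (ℕ.[m+kn]%n≡m%n 1 n 2))) ⟩
    fromℕ (suc (2 ℕ.* n) !) * 0ℚ
      ≡⟨ *-zeroʳ (fromℕ (suc (2 ℕ.* n) !)) ⟩
    0ℚ
      ≡⟨ *-zeroˡ (noncrossingCount (suc (2 ℕ.* n))) ⟨
    0ℚ * noncrossingCount (suc (2 ℕ.* n))
      ≡⟨ cong (_* noncrossingCount (suc (2 ℕ.* n))) (ε-odd n) ⟨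
    signedNoncrossing (suc (2 ℕ.* n)) ∎

  -- Both derivatives solve the same equation, and M has constant term 1. Index 0 is excluded: the
  -- series has constant term 0, while the empty configuration is good.
  egf-logM≡goodCount : ∀ m → egf (λ m → - logM m) (suc m) ≡ goodCount (suc m)
  egf-logM≡goodCount = ⊗-cancelʳ (D (egf (λ m → - logM m))) (D goodCount) (egf Mser) Mser-0 λ m → begin
    (D (egf (λ m → - logM m)) ⊗ egf Mser) m      ≡⟨ egf-logM-⊗ m ⟩
    - 1ℚ * D (egf Mser) m                        ≡⟨ cong (- 1ℚ *_) (egf-Mser (suc m)) ⟩
    - 1ℚ * D signedNoncrossing m                 ≡⟨ good-recurrence m ⟨
    (D goodCount ⊗ signedNoncrossing) m          ≡⟨ ⊗-cong (λ _ → refl) egf-Mser m ⟨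
    (D goodCount ⊗ egf Mser) m ∎
    where
    Mser-0 : egf Mser 0 ≡ 1ℚ
    Mser-0 = trans (cong (_* 1ℚ) fromℕ-1) refl

  ktilde≡goodCount : ∀ n → 1 ℕ.≤ n → ktilde n ≡ goodCount (2 ℕ.* n)
  ktilde≡goodCount (suc n) _ = trans
    (cong (_* - logM (2 ℕ.* suc n)) (sym (fromℕ-/ ((2 ℕ.* suc n) !))))
    -- `2 * suc n` computes to the successor of this index.
    (egf-logM≡goodCount (n ℕ.+ suc (n ℕ.+ 0)))

-- The list of all pairs

open FiniteSums
open Matchings
open Split
open Cumulants
open import Data.List using (filter)
open import Data.List.Membership.Propositional.Properties using (∈-filter⁺; ∈-filter⁻)
open import Data.List.Relation.Unary.Unique.Propositional.Properties using (filter⁺)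
open import Data.Product using (_,_; proj₂)
open import Function using (mk⇔)
open import Relation.Binary.PropositionalEquality using (trans; sym)
open import Defs
open import Data.Nat using (ℕ; _≤_; _*_)
open import Data.Bool using (Bool)
open import Data.Fin using (Fin)
open import Data.Vec using (Vec)
open import Data.List using (List; length)
open import Data.List.Membership.Propositional using (_∈_)
open import Data.List.Relation.Unary.Unique.Propositional using (Unique)
open import Data.Product using (_×_; Σ-syntax)
open import Function.Bundles using (_⇔_)
open import Data.Integer using (+_)
open import Data.Rational using (_/_)
open import Relation.Binary.PropositionalEquality using (_≡_)

theorem5p7 : (n : ℕ) → 1 ≤ n →
    Σ[ L ∈ List (Vec (Fin (2 * n)) (2 * n) × Vec (Vec Bool (2 * n)) (2 * n)) ]
    (Unique L × (∀ x → (x ∈ L) ⇔ Good n x) × (ktilde n ≡ (+ length L) / 1))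
theorem5p7 n 1≤n =
  L , filter⁺ good? unique ,
  (λ x → mk⇔ (λ x∈L → proj₂ (∈-filter⁻ good? {xs = configurations} x∈L)) (∈-filter⁺ good? (complete x))) ,
  trans (ktilde≡goodCount n 1≤n) (trans (sym (length-filter good? configurations)) (fromℕ-/ (length L)))
  where
  configurations L : List (Configuration (2 * n))
  configurations = enum
  L = filter good? configurations
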